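{- For every integer $q\geq 4$, there exist a real constant $c>1$ and infinitely many balanced partite-$K_q$-divisible $q$-partite graphs $G$ with $\hat{\delta}(G)\geq \left(1-\frac{1}{c\cdot (q+1)}\right)\frac{v(G)}{q}$ such that $G$ has no $K_q$-decomposition and even no fractional $K_q$-decomposition.
   Context: Graphs are finite, simple and undirected, and "infinitely many" is understood up to isomorphism; $v(G)$ is the number of vertices of $G$. A graph $G$ is $q$-partite with $q$-partition $(V_1,\ldots,V_q)$ if $(V_1,\ldots,V_q)$ is a partition of $V(G)$ and each $V_i$ is an independent set in $G$; it is balanced if $|V_1|=\cdots=|V_q|$. For a vertex $x$ and a set $U\subseteq V(G)$, $d(x,U)$ denotes the number of neighbours of $x$ in $U$. For such a $G$ (with its $q$-partition), the partite minimum degree is $\hat{\delta}(G):=\min\{d(x,V_j): 1\leq j\leq q,\ x\in V(G)\setminus V_j\}$. A balanced $q$-partite graph $G$ with $q$-partition $(V_1,\ldots,V_q)$ is partite-$K_q$-divisible if for all integers $1\leq j_1<j_2\leq q$ and every $x\in V(G)\setminus (V_{j_1}\cup V_{j_2})$ we have $d(x,V_{j_1})=d(x,V_{j_2})$. A $K_q$-decomposition of $G$ is a partition of the edge set of $G$ into (edge sets of) edge-disjoint copies of $K_q$ in $G$. A fractional $K_q$-decomposition of $G$ is an assignment of non-negative real weights to the copies of $K_q$ in $G$ such that for every edge $e$ of $G$, the total weight of the copies of $K_q$ containing $e$ is exactly $1$. -}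

module Defs where

open import Level using (0ℓ)
open import Data.Nat as ℕ using (ℕ; zero; suc)
import Data.Nat.Properties as ℕ
open import Data.Integer using (+_)
open import Data.Rational as ℚ using (ℚ; 0ℚ; 1ℚ; ½; ∣_∣)
import Data.Rational.Properties as ℚ
open import Data.Rational.Solver using (module +-*-Solver)
open import Data.Fin as Fin using (Fin)
import Data.Fin.Properties as Fin
open import Data.Fin.Subset as Subset using (Subset; _∈_; _∉_; _∩_; _∪_; inside; outside)
open import Data.Fin.Subset.Properties using (_∈?_)
open import Data.List as List using (List; []; _∷_; _++_; filter; concatMap; allFin)
open import Data.List.Extrema.Nat using (min)
open import Data.List.Relation.Unary.All using (All)
open import Data.List.Relation.Unary.Any using (Any)
open import Data.List.Relation.Unary.AllPairs using (AllPairs)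
open import Data.Product using (Σ; ∃; ∃-syntax; _×_; _,_; proj₁; proj₂)
open import Data.Vec as Vec using ([]; _∷_)
open import Function.Bundles using (_↔_; _⇔_; Inverse)
open import Relation.Binary using (Rel; Decidable; Symmetric)
open import Relation.Binary.PropositionalEquality
  using (_≡_; _≢_; refl; sym; trans; cong; cong₂; subst)
open import Relation.Nullary using (¬_; Dec; does)
open import Relation.Nullary.Decidable using (_×-dec_; _→-dec_; ¬?)

private
  module Estimates where
    open import Data.Rational using (_+_; _*_; _-_; -_; 1/_; _<_; _≤_; positive; nonNegative; >-nonZero)
    open ℚ.≤-Reasoning
    open +-*-Solver using (solve; _:+_; _:*_; _:-_; :-_; _:=_; con)

    half>0 : ∀ {ε} → 0ℚ < ε → 0ℚ < ε * ½
    half>0 {ε} 0<ε = subst (_< ε * ½) (ℚ.*-zeroˡ ½) (ℚ.*-monoˡ-<-pos ½ 0<ε)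

    half+half : ∀ ε → ε * ½ + ε * ½ ≡ ε
    half+half ε = trans (sym (ℚ.*-distribˡ-+ ε ½ ½)) (ℚ.*-identityʳ ε)

    *>0 : ∀ {a b} → 0ℚ < a → 0ℚ < b → 0ℚ < a * b
    *>0 {a} {b} 0<a 0<b =
      subst (_< a * b) (ℚ.*-zeroˡ b) (ℚ.*-monoˡ-<-pos b {{positive 0<b}} 0<a)

    1/>0 : ∀ {a} (0<a : 0ℚ < a) → 0ℚ < (1/ a) {{>-nonZero 0<a}}
    1/>0 {a} 0<a = ℚ.positive⁻¹ _ {{ℚ.1/pos⇒pos a {{positive 0<a}}}}

    *-mono : ∀ {a b c d} → 0ℚ ≤ b → 0ℚ ≤ c → a ≤ c → b ≤ d → a * b ≤ c * d
    *-mono {a} {b} {c} {d} 0≤b 0≤c a≤c b≤d = begin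
      a * b ≤⟨ ℚ.*-monoʳ-≤-nonNeg b {{nonNegative 0≤b}} a≤c ⟩
      c * b ≤⟨ ℚ.*-monoˡ-≤-nonNeg c {{nonNegative 0≤c}} b≤d ⟩
      c * d ∎

    +-est : ∀ a b c d {ε} → ∣ a - c ∣ < ε * ½ → ∣ b - d ∣ < ε * ½ →
            ∣ (a + b) - (c + d) ∣ < ε
    +-est a b c d {ε} p r = begin-strict
      ∣ (a + b) - (c + d) ∣   ≡⟨ cong ∣_∣ (solve 4 (λ a b c d →
                                   (a :+ b) :- (c :+ d) := (a :- c) :+ (b :- d)) refl a b c d) ⟩
      ∣ (a - c) + (b - d) ∣   ≤⟨ ℚ.∣p+q∣≤∣p∣+∣q∣ (a - c) (b - d) ⟩
      ∣ a - c ∣ + ∣ b - d ∣   <⟨ ℚ.+-mono-< p r ⟩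
      ε * ½ + ε * ½           ≡⟨ half+half ε ⟩
      ε                       ∎

    neg-est : ∀ a c → ∣ (- a) - (- c) ∣ ≡ ∣ a - c ∣
    neg-est a c = trans
      (cong ∣_∣ (solve 2 (λ a c → (:- a) :- (:- c) := :- (a :- c)) refl a c))
      (ℚ.∣-p∣≡∣p∣ (a - c))

    bound : ∀ a c → ∣ a - c ∣ < 1ℚ → ∣ a ∣ < ∣ c ∣ + 1ℚ
    bound a c p = begin-strict
      ∣ a ∣               ≡⟨ cong ∣_∣ (solve 2 (λ a c → a := c :+ (a :- c)) refl a c) ⟩
      ∣ c + (a - c) ∣     ≤⟨ ℚ.∣p+q∣≤∣p∣+∣q∣ c (a - c) ⟩
      ∣ c ∣ + ∣ a - c ∣   <⟨ ℚ.+-monoʳ-< ∣ c ∣ p ⟩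
      ∣ c ∣ + 1ℚ          ∎

    bound>0 : ∀ c → 0ℚ < ∣ c ∣ + 1ℚ
    bound>0 c = ℚ.+-mono-≤-< (ℚ.0≤∣p∣ c) (ℚ.positive⁻¹ 1ℚ)

    scale : ∀ ε {A} (0<A : 0ℚ < A) → ℚ
    scale ε {A} 0<A = (ε * ½) * (1/ A) {{>-nonZero 0<A}}

    scale>0 : ∀ {ε A} (0<A : 0ℚ < A) → 0ℚ < ε → 0ℚ < scale ε 0<A
    scale>0 0<A 0<ε = *>0 (half>0 0<ε) (1/>0 0<A)

    scale-est : ∀ a b {ε A} (0<A : 0ℚ < A) → ∣ a ∣ < A → ∣ b ∣ < scale ε 0<A →
                ∣ a * b ∣ < ε * ½
    scale-est a b {ε} {A} 0<A p r = begin-strict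
      ∣ a * b ∣                 ≡⟨ ℚ.∣p*q∣≡∣p∣*∣q∣ a b ⟩
      ∣ a ∣ * ∣ b ∣             ≤⟨ ℚ.*-monoʳ-≤-nonNeg ∣ b ∣ {{ℚ.∣-∣-nonNeg b}} (ℚ.<⇒≤ p) ⟩
      A * ∣ b ∣                 <⟨ ℚ.*-monoʳ-<-pos A {{positive 0<A}} r ⟩
      A * ((ε * ½) * 1/A)       ≡⟨ solve 3 (λ A e i → A :* (e :* i) := e :* (A :* i)) refl
                                     A (ε * ½) 1/A ⟩
      (ε * ½) * (A * 1/A)       ≡⟨ cong ((ε * ½) *_) (ℚ.*-inverseʳ A {{>-nonZero 0<A}}) ⟩
      (ε * ½) * 1ℚ              ≡⟨ ℚ.*-identityʳ (ε * ½) ⟩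
      ε * ½                     ∎
      where
      1/A : ℚ
      1/A = (1/ A) {{>-nonZero 0<A}}

    *-est : ∀ a b c d {ε A D} (0<A : 0ℚ < A) (0<D : 0ℚ < D) →
            ∣ a ∣ < A → ∣ d ∣ < D →
            ∣ a - c ∣ < scale ε 0<D → ∣ b - d ∣ < scale ε 0<A →
            ∣ a * b - c * d ∣ < ε
    *-est a b c d {ε} 0<A 0<D p r s t = begin-strict
      ∣ a * b - c * d ∣                     ≡⟨ cong ∣_∣ (solve 4 (λ a b c d →
                                                 a :* b :- c :* d :=
                                                 a :* (b :- d) :+ d :* (a :- c)) refl a b c d) ⟩
      ∣ a * (b - d) + d * (a - c) ∣         ≤⟨ ℚ.∣p+q∣≤∣p∣+∣q∣ (a * (b - d)) (d * (a - c)) ⟩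
      ∣ a * (b - d) ∣ + ∣ d * (a - c) ∣     <⟨ ℚ.+-mono-< (scale-est a (b - d) {ε} 0<A p t)
                                                          (scale-est d (a - c) {ε} 0<D r s) ⟩
      ε * ½ + ε * ½                         ≡⟨ half+half ε ⟩
      ε                                     ∎

    1/-est : ∀ a c {ε d} (0<ε : 0ℚ < ε) (0<d : 0ℚ < d) →
             (0<a : 0ℚ < a) (0<c : 0ℚ < c) → d ≤ a → d ≤ c →
             ∣ a - c ∣ < ε * (d * d) →
             ∣ (1/ a) {{>-nonZero 0<a}} - (1/ c) {{>-nonZero 0<c}} ∣ < ε
    1/-est a c {ε} {d} 0<ε 0<d 0<a 0<c d≤a d≤c p =
      ℚ.*-cancelʳ-<-nonNeg (a * c) {{nonNegative (ℚ.<⇒≤ 0<ac)}} (begin-strict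
        ∣ i - j ∣ * (a * c)       ≡⟨ cong (∣ i - j ∣ *_) (sym (ℚ.0≤p⇒∣p∣≡p (ℚ.<⇒≤ 0<ac))) ⟩
        ∣ i - j ∣ * ∣ a * c ∣     ≡⟨ sym (ℚ.∣p*q∣≡∣p∣*∣q∣ (i - j) (a * c)) ⟩
        ∣ (i - j) * (a * c) ∣     ≡⟨ cong ∣_∣ (solve 4 (λ i j a c →
                                       (i :- j) :* (a :* c) :=
                                       (a :* i) :* c :- (c :* j) :* a) refl i j a c) ⟩
        ∣ (a * i) * c - (c * j) * a ∣
          ≡⟨ cong₂ (λ s t → ∣ s * c - t * a ∣)
               (ℚ.*-inverseʳ a {{>-nonZero 0<a}}) (ℚ.*-inverseʳ c {{>-nonZero 0<c}}) ⟩
        ∣ 1ℚ * c - 1ℚ * a ∣       ≡⟨ cong₂ (λ s t → ∣ s - t ∣)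
                                       (ℚ.*-identityˡ c) (ℚ.*-identityˡ a) ⟩
        ∣ c - a ∣                 ≡⟨ trans (sym (ℚ.∣-p∣≡∣p∣ (c - a))) (cong ∣_∣
                                       (solve 2 (λ a c → :- (c :- a) := a :- c) refl a c)) ⟩
        ∣ a - c ∣                 <⟨ p ⟩
        ε * (d * d)               ≤⟨ ℚ.*-monoˡ-≤-nonNeg ε {{nonNegative (ℚ.<⇒≤ 0<ε)}}
                                       (*-mono (ℚ.<⇒≤ 0<d) (ℚ.<⇒≤ 0<a) d≤a d≤c) ⟩
        ε * (a * c)               ∎)
      where
      i j : ℚ
      i = (1/ a) {{>-nonZero 0<a}}
      j = (1/ c) {{>-nonZero 0<c}}
      0<ac : 0ℚ < a * c
      0<ac = *>0 0<a 0<c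

  open Estimates

-- A real number is a Cauchy sequence of rationals; equality of reals is _≈ℝ_,
-- not _≡_.
record ℝ : Set where
  field
    seq    : ℕ → ℚ
    cauchy : ∀ ε → 0ℚ ℚ.< ε →
             ∃[ N ] (∀ m n → N ℕ.≤ m → N ℕ.≤ n → ∣ seq m ℚ.- seq n ∣ ℚ.< ε)

open ℝ public

infix  4 _≈ℝ_ _≤ℝ_ _<ℝ_
infixl 6 _+ℝ_ _-ℝ_
infixl 7 _*ℝ_

_≈ℝ_ : Rel ℝ 0ℓ
x ≈ℝ y = ∀ ε → 0ℚ ℚ.< ε → ∃[ N ] (∀ n → N ℕ.≤ n → ∣ seq x n ℚ.- seq y n ∣ ℚ.< ε)

_≤ℝ_ : Rel ℝ 0ℓ
x ≤ℝ y = ∀ ε → 0ℚ ℚ.< ε → ∃[ N ] (∀ n → N ℕ.≤ n → seq x n ℚ.≤ seq y n ℚ.+ ε)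

_<ℝ_ : Rel ℝ 0ℓ
x <ℝ y = ∃[ δ ] (0ℚ ℚ.< δ × ∃[ N ] (∀ n → N ℕ.≤ n → seq x n ℚ.+ δ ℚ.≤ seq y n))

fromℚ : ℚ → ℝ
fromℚ p = record
  { seq    = λ _ → p
  ; cauchy = λ ε 0<ε → 0 , λ _ _ _ _ →
      subst (ℚ._< ε) (sym (cong ∣_∣ (ℚ.+-inverseʳ p))) 0<ε
  }

fromℕ : ℕ → ℝ
fromℕ n = fromℚ (+ n ℚ./ 1)

0ℝ 1ℝ : ℝ
0ℝ = fromℚ 0ℚ
1ℝ = fromℚ 1ℚ

_+ℝ_ : ℝ → ℝ → ℝ
x +ℝ y = record
  { seq    = λ n → seq x n ℚ.+ seq y n
  ; cauchy = λ ε 0<ε →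
      let M , f = cauchy x (ε ℚ.* ½) (half>0 0<ε)
          N , g = cauchy y (ε ℚ.* ½) (half>0 0<ε)
      in M ℕ.⊔ N , λ m n K≤m K≤n →
        +-est (seq x m) (seq y m) (seq x n) (seq y n)
          (f m n (ℕ.m⊔n≤o⇒m≤o M N K≤m) (ℕ.m⊔n≤o⇒m≤o M N K≤n))
          (g m n (ℕ.m⊔n≤o⇒n≤o M N K≤m) (ℕ.m⊔n≤o⇒n≤o M N K≤n))
  }

-ℝ_ : ℝ → ℝ
-ℝ x = record
  { seq    = λ n → ℚ.- seq x n
  ; cauchy = λ ε 0<ε →
      let N , f = cauchy x ε 0<ε
      in N , λ m n N≤m N≤n →
        subst (ℚ._< ε) (sym (neg-est (seq x m) (seq x n))) (f m n N≤m N≤n)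
  }

_-ℝ_ : ℝ → ℝ → ℝ
x -ℝ y = x +ℝ (-ℝ y)

_*ℝ_ : ℝ → ℝ → ℝ
x *ℝ y = record
  { seq    = λ n → seq x n ℚ.* seq y n
  ; cauchy = λ ε 0<ε →
      let I , bx = cauchy x 1ℚ (ℚ.positive⁻¹ 1ℚ)
          J , by = cauchy y 1ℚ (ℚ.positive⁻¹ 1ℚ)
          0<A    = bound>0 (seq x I)
          0<D    = bound>0 (seq y J)
          M , f  = cauchy x (scale ε 0<D) (scale>0 0<D 0<ε)
          N , g  = cauchy y (scale ε 0<A) (scale>0 0<A 0<ε)
      in (I ℕ.⊔ J) ℕ.⊔ (M ℕ.⊔ N) , λ m n K≤m K≤n →
        let IJ≤m = ℕ.m⊔n≤o⇒m≤o (I ℕ.⊔ J) (M ℕ.⊔ N) K≤m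
            IJ≤n = ℕ.m⊔n≤o⇒m≤o (I ℕ.⊔ J) (M ℕ.⊔ N) K≤n
            MN≤m = ℕ.m⊔n≤o⇒n≤o (I ℕ.⊔ J) (M ℕ.⊔ N) K≤m
            MN≤n = ℕ.m⊔n≤o⇒n≤o (I ℕ.⊔ J) (M ℕ.⊔ N) K≤n
        in *-est (seq x m) (seq y m) (seq x n) (seq y n) 0<A 0<D
             (bound (seq x m) (seq x I) (bx m I (ℕ.m⊔n≤o⇒m≤o I J IJ≤m) ℕ.≤-refl))
             (bound (seq y n) (seq y J) (by n J (ℕ.m⊔n≤o⇒n≤o I J IJ≤n) ℕ.≤-refl))
             (f m n (ℕ.m⊔n≤o⇒m≤o M N MN≤m) (ℕ.m⊔n≤o⇒m≤o M N MN≤n))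
             (g m n (ℕ.m⊔n≤o⇒n≤o M N MN≤m) (ℕ.m⊔n≤o⇒n≤o M N MN≤n))
  }

private
  lower : ∀ (x : ℝ) δ N → (∀ n → N ℕ.≤ n → 0ℚ ℚ.+ δ ℚ.≤ seq x n) →
          ∀ n → δ ℚ.≤ seq x (N ℕ.+ n)
  lower x δ N h n =
    subst (ℚ._≤ seq x (N ℕ.+ n)) (ℚ.+-identityˡ δ) (h (N ℕ.+ n) (ℕ.m≤m+n N n))

-- The sequence is shifted past the point from which x is bounded away
-- from 0, so that every term has a reciprocal; the shift does not affect
-- the limit.
recip : (x : ℝ) → 0ℝ <ℝ x → ℝ
recip x (δ , 0<δ , N , h) = record
  { seq    = λ n → (ℚ.1/ seq x (N ℕ.+ n)) {{ℚ.>-nonZero (pos n)}}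
  ; cauchy = λ ε 0<ε →
      let M , f = cauchy x (ε ℚ.* (δ ℚ.* δ)) (*>0 0<ε (*>0 0<δ 0<δ))
      in M , λ m n M≤m M≤n →
        1/-est (seq x (N ℕ.+ m)) (seq x (N ℕ.+ n)) 0<ε 0<δ (pos m) (pos n)
          (lower x δ N h m) (lower x δ N h n)
          (f (N ℕ.+ m) (N ℕ.+ n) (ℕ.m≤n⇒m≤o+n N M≤m) (ℕ.m≤n⇒m≤o+n N M≤n))
  }
  where
  pos : ∀ n → 0ℚ ℚ.< seq x (N ℕ.+ n)
  pos n = ℚ.<-≤-trans 0<δ (lower x δ N h n)

1<⇒0< : ∀ {c} → 1ℝ <ℝ c → 0ℝ <ℝ c
1<⇒0< (δ , 0<δ , N , h) = δ , 0<δ , N , λ n N≤n →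
  ℚ.≤-trans (ℚ.+-monoˡ-≤ δ (ℚ.<⇒≤ (ℚ.positive⁻¹ 1ℚ))) (h n N≤n)

0<suc : ∀ n → 0ℝ <ℝ fromℕ (suc n)
0<suc n = p , ℚ.positive⁻¹ p {{ℚ.normalize-pos (suc n) 1}} , 0 ,
  λ _ _ → ℚ.≤-reflexive (ℚ.+-identityˡ p)
  where
  p : ℚ
  p = + suc n ℚ./ 1

0<* : ∀ {x y} → 0ℝ <ℝ x → 0ℝ <ℝ y → 0ℝ <ℝ x *ℝ y
0<* {x} {y} (δ , 0<δ , M , f) (η , 0<η , N , g) =
  δ ℚ.* η , *>0 0<δ 0<η , M ℕ.⊔ N , λ n K≤n →
    let p = subst (ℚ._≤ seq x n) (ℚ.+-identityˡ δ) (f n (ℕ.m⊔n≤o⇒m≤o M N K≤n))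
        r = subst (ℚ._≤ seq y n) (ℚ.+-identityˡ η) (g n (ℕ.m⊔n≤o⇒n≤o M N K≤n))
    in subst (ℚ._≤ seq x n ℚ.* seq y n) (sym (ℚ.+-identityˡ (δ ℚ.* η)))
         (*-mono (ℚ.<⇒≤ 0<η) (ℚ.≤-trans (ℚ.<⇒≤ 0<δ) p) p r)

sumℝ : List ℝ → ℝ
sumℝ = List.foldr _+ℝ_ 0ℝ

record Graph : Set₁ where
  infix 4 _~_ _~?_
  field
    v        : ℕ
    _~_      : Rel (Fin v) 0ℓ
    _~?_     : Decidable _~_
    ~-sym    : Symmetric _~_
    ~-irrefl : ∀ {x} → ¬ (x ~ x)

  neighbours : Fin v → Subset v
  neighbours x = Vec.tabulate (λ y → does (x ~? y))

  d : Fin v → Subset v → ℕ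
  d x U = Subset.∣ neighbours x ∩ U ∣

infix 4 _≅_

record _≅_ (G H : Graph) : Set where
  private
    module G = Graph G
    module H = Graph H
  field
    bijection : Fin G.v ↔ Fin H.v
    adjacency : ∀ x y →
      (x G.~ y) ⇔ (Inverse.to bijection x H.~ Inverse.to bijection y)

subsets : ∀ n → List (Subset n)
subsets zero    = [] ∷ []
subsets (suc n) = List.map (outside ∷_) (subsets n) ++ List.map (inside ∷_) (subsets n)

module Decompositions (q : ℕ) (G : Graph) where
  open Graph G

  -- A copy of K_q is identified with its vertex set.
  IsCopy : Subset v → Set
  IsCopy S = Subset.∣ S ∣ ≡ q × (∀ x y → x ∈ S → y ∈ S → x ≢ y → x ~ y)

  isCopy? : ∀ S → Dec (IsCopy S)
  isCopy? S = (Subset.∣ S ∣ ℕ.≟ q) ×-dec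
    Fin.all? λ x → Fin.all? λ y →
      (x ∈? S) →-dec ((y ∈? S) →-dec (¬? (x Fin.≟ y) →-dec (x ~? y)))

  copies : List (Subset v)
  copies = filter isCopy? (subsets v)

  Contains : Fin v → Fin v → Subset v → Set
  Contains x y S = x ∈ S × y ∈ S

  contains? : ∀ x y S → Dec (Contains x y S)
  contains? x y S = (x ∈? S) ×-dec (y ∈? S)

  EdgeDisjoint : Rel (Subset v) 0ℓ
  EdgeDisjoint S T = ∀ x y → x ~ y → ¬ (Contains x y S × Contains x y T)

  record Decomposition : Set where
    field
      parts    : List (Subset v)
      areCopy  : All IsCopy parts
      disjoint : AllPairs EdgeDisjoint parts
      covers   : ∀ x y → x ~ y → Any (Contains x y) parts

  -- Values of weight on sets that are not copies of K_q are unconstrained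
  -- and unused.
  record FractionalDecomposition : Set where
    field
      weight   : Subset v → ℝ
      nonNeg   : ∀ S → IsCopy S → 0ℝ ≤ℝ weight S
      total    : ∀ x y → x ~ y →
                 sumℝ (List.map weight (filter (contains? x y) copies)) ≈ℝ 1ℝ

open Decompositions public using (Decomposition; FractionalDecomposition)

record PartiteGraph (q : ℕ) : Set₁ where
  field
    graph : Graph
  open Graph graph public
  field
    V           : Fin q → Subset v
    covering    : ∀ x → ∃[ j ] x ∈ V j
    disjoint    : ∀ {x i j} → x ∈ V i → x ∈ V j → i ≡ j
    independent : ∀ j {x y} → x ∈ V j → y ∈ V j → ¬ (x ~ y)

  Balanced : Set
  Balanced = ∀ i j → Subset.∣ V i ∣ ≡ Subset.∣ V j ∣

  PartiteDivisible : Set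
  PartiteDivisible = ∀ j₁ j₂ → j₁ Fin.< j₂ →
    ∀ x → x ∉ V j₁ ∪ V j₂ → d x (V j₁) ≡ d x (V j₂)

  partiteDegrees : List ℕ
  partiteDegrees = concatMap
    (λ j → List.map (λ x → d x (V j)) (filter (λ x → ¬? (x ∈? V j)) (allFin v)))
    (allFin q)

  -- The library's min takes a default, returned for the empty list. Since
  -- no degree exceeds v, the default v does not affect other minima.
  δ̂ : ℕ
  δ̂ = min v partiteDegrees

threshold : (c : ℝ) → 1ℝ <ℝ c → (q : ℕ) → .{{ℕ.NonZero q}} → ℕ → ℝ
threshold c 1<c q n =
  (1ℝ -ℝ recip (c *ℝ fromℕ (suc q)) c[q+1]>0) *ℝ fromℚ (+ n ℚ./ q)
  where
  c[q+1]>0 : 0ℝ <ℝ c *ℝ fromℕ (suc q)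
  c[q+1]>0 = 0<* {c} {fromℕ (suc q)} (1<⇒0< {c} 1<c) (0<suc q)

{-# OPTIONS --safe #-}
-- Each part is split as A ∪ B with ∣ A ∣ = 3/(2q) of the part. Vertices in
-- different parts are adjacent if one lies in A and the other in B, while inside A
-- and inside B every vertex misses exactly e vertices of each other part. A copy of
-- K_q with x vertices in A has (x - 1) (x - 2) ≥ 0, with equality only for the two
-- integers next to the average q ∣ A ∣ / (∣ A ∣ + ∣ B ∣) = 3/2. Up to the factor
-- q (q - 1) this quantity is the sum over the copy of an edge weighting, with weights
-- (q - 1) (q - 2) inside A, 2 inside B and - (q - 2) across (ordered pairs). The
-- weighting is therefore nonnegative on every copy, but its total over the graph is
-- negative already for some e less than 1/(q + 1) of the part, since (q - 3)² > 0.

module Submission where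

open import Defs
open import Data.Nat using (ℕ; _≤_; s≤s; z≤n; >-nonZero)
open import Data.Nat.Properties using (≤-trans)
open import Data.Product using (Σ; ∃-syntax; _×_)
open import Relation.Binary.PropositionalEquality using (_≢_)
open import Relation.Nullary using (¬_)

open import Algebra.Bundles using (CommutativeRing)
open import Data.Bool using (Bool; true; false; _∧_; not)
open import Data.Fin as Fin using (Fin; zero; suc; toℕ; _↑ˡ_; _↑ʳ_; splitAt; combine; remQuot)
open import Data.Fin.Permutation using (↔⇒≡)
import Data.Fin.Properties as Fin
open import Data.Fin.Subset as Subset using (Subset; _∈_; _∩_)
open import Data.Fin.Subset.Properties as Subset using (_∈?_)
import Data.Integer as ℤ
import Data.Integer.Properties as ℤ
open import Data.List as List using (List; []; _∷_; filter)
open import Data.List.Extrema.Nat using (v≤min⁺)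
open import Data.List.Membership.Propositional.Properties using (∈-allFin)
import Data.List.Properties as List
open import Data.List.Relation.Unary.All as All using (All; []; _∷_)
import Data.List.Relation.Unary.All.Properties as All
open import Data.List.Relation.Unary.AllPairs using (AllPairs; []; _∷_)
open import Data.List.Relation.Unary.Any as Any using (Any)
open import Data.Nat as ℕ using (zero; suc; _+_; _*_; _<_; NonZero)
open import Data.Nat.DivMod using (_%_; m<n⇒m%n≡m; [m+n]%n≡m%n)
import Data.Nat.Properties as ℕ
import Data.Nat.Solver as ℕ
open import Data.Product using (_,_; proj₁; proj₂; uncurry; map₂)
open import Data.Rational as ℚ using (ℚ; 0ℚ; 1ℚ)
import Data.Rational.Properties as ℚ
import Data.Rational.Solver as ℚ
import Data.Rational.Unnormalised as ℚᵘ
import Data.Rational.Unnormalised.Properties as ℚᵘ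
open import Data.Sum using (_⊎_; inj₁; inj₂)
open import Data.Unit using (⊤; tt)
open import Data.Vec using ([]; _∷_; lookup; tabulate)
import Data.Vec.Properties as Vec
open import Function using (_∘_)
open import Relation.Binary using (Decidable; Symmetric)
open import Relation.Binary.PropositionalEquality
  using (_≡_; refl; sym; trans; cong; cong₂; subst; subst₂; ≢-sym; module ≡-Reasoning)
open import Relation.Nullary using (yes; no; does; contradiction)
open import Relation.Nullary.Decidable using (_×-dec_; ¬?; dec-true; dec-false)

open import Algebra.Properties.Semiring.Sum ℕ.+-*-semiring
  using (sum; sum-syntax; sum-cong-≗; ∑-distrib-+; *-distribˡ-sum; *-distribʳ-sum)
open import Algebra.Properties.Semiring.Sum (CommutativeRing.semiring ℚ.+-*-commutativeRing)
  using () renaming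
  ( sum to sumℚ; sum-cong-≗ to sumℚ-cong; ∑-distrib-+ to sumℚ-+
  ; *-distribˡ-sum to *-distribˡ-sumℚ; sum-replicate-zero to sumℚ-0 )

-- Iverson brackets and finite sums of natural numbers.

[_] : Bool → ℕ
[ true  ] = 1
[ false ] = 0

[]-∧ : ∀ a b → [ a ∧ b ] ≡ [ a ] * [ b ]
[]-∧ true  b = sym (ℕ.+-identityʳ [ b ])
[]-∧ false b = refl

[]+[not] : ∀ b → [ b ] + [ not b ] ≡ 1
[]+[not] true  = refl
[]+[not] false = refl

sum-0 : ∀ n → ∑[ i < n ] 0 ≡ 0
sum-0 zero    = refl
sum-0 (suc n) = sum-0 n

sum-const : ∀ n c → ∑[ i < n ] c ≡ n * c
sum-const zero    c = refl
sum-const (suc n) c = cong (c ℕ.+_) (sum-const n c)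

sum-+ : ∀ a b (f : Fin (a + b) → ℕ) →
        sum f ≡ ∑[ i < a ] f (i ↑ˡ b) + ∑[ j < b ] f (a ↑ʳ j)
sum-+ zero    b f = refl
sum-+ (suc a) b f = trans (cong (f zero ℕ.+_) (sum-+ a b (f ∘ suc))) (sym (ℕ.+-assoc (f zero) _ _))

sum-combine : ∀ m n (f : Fin (m * n) → ℕ) →
              sum f ≡ ∑[ i < m ] ∑[ j < n ] f (combine i j)
sum-combine zero    n f = refl
sum-combine (suc m) n f = trans (sum-+ n (m * n) f)
  (cong (∑[ j < n ] f (j ↑ˡ (m * n)) ℕ.+_) (sum-combine m n (f ∘ (n ↑ʳ_))))

sum-*-sum : ∀ {m n} (f : Fin m → ℕ) (g : Fin n → ℕ) →
            ∑[ i < m ] ∑[ j < n ] (f i * g j) ≡ sum f * sum g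
sum-*-sum f g = trans (sum-cong-≗ λ i → sym (*-distribˡ-sum (f i) g))
                      (sym (*-distribʳ-sum (sum g) f))

sum-≟ : ∀ {n} (i : Fin n) (f : Fin n → ℕ) → ∑[ j < n ] ([ does (i Fin.≟ j) ] * f j) ≡ f i
sum-≟ {suc n} zero f = trans (cong₂ _+_ (ℕ.+-identityʳ (f zero)) (sum-0 n)) (ℕ.+-identityʳ (f zero))
sum-≟ (suc i) f = trans (sum-cong-≗ λ j → cong (λ b → [ b ] * f (suc j)) (does-suc j))
                        (sum-≟ i (f ∘ suc))
  where
  does-suc : ∀ j → does (suc i Fin.≟ suc j) ≡ does (i Fin.≟ j)
  does-suc j with i Fin.≟ j
  ... | yes _ = refl
  ... | no  _ = refl

-- Both sides are the sum of `f` over 0, ..., `n`, split at the first or at the last term.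
sum-shift : ∀ n (f : ℕ → ℕ) → ∑[ i < n ] f (suc (toℕ i)) + f 0 ≡ ∑[ i < n ] f (toℕ i) + f n
sum-shift zero    f = refl
sum-shift (suc n) f = begin
  (f 1 + s) + f 0
    ≡⟨ solve 3 (λ x y z → (x :+ y) :+ z := z :+ (y :+ x)) refl (f 1) s (f 0) ⟩
  f 0 + (s + f 1)
    ≡⟨ cong (f 0 +_) (sum-shift n (f ∘ suc)) ⟩
  f 0 + (∑[ i < n ] f (suc (toℕ i)) + f (suc n))
    ≡⟨ sym (ℕ.+-assoc (f 0) _ _) ⟩
  f 0 + ∑[ i < n ] f (suc (toℕ i)) + f (suc n) ∎
  where
  open ≡-Reasoning
  open ℕ.+-*-Solver using (solve; _:+_; _:=_)
  s = ∑[ i < n ] f (suc (suc (toℕ i)))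

-- Induction on the shift: raising it by one drops the term at index 0 and adds the term at index
-- `n`, and these agree by periodicity. This is what makes every row of the relation
-- `e ≤ (i + j) % a` contain equally many entries.
sum-rotate : ∀ n .{{_ : NonZero n}} s (f : ℕ → ℕ) →
             ∑[ i < n ] f ((s + toℕ i) % n) ≡ ∑[ i < n ] f (toℕ i)
sum-rotate n zero    f = sum-cong-≗ {n} λ i → cong f (m<n⇒m%n≡m (Fin.toℕ<n i))
sum-rotate n (suc s) f = trans (ℕ.+-cancelʳ-≡ (g 0) _ _ (begin
  ∑[ i < n ] f ((suc s + toℕ i) % n) + g 0
    ≡⟨ cong (_+ g 0) (sum-cong-≗ {n} λ i → cong (λ t → f (t % n)) (sym (ℕ.+-suc s (toℕ i)))) ⟩
  ∑[ i < n ] g (suc (toℕ i)) + g 0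
    ≡⟨ sum-shift n g ⟩
  ∑[ i < n ] g (toℕ i) + g n
    ≡⟨ cong (λ t → ∑[ i < n ] g (toℕ i) + f t)
         (trans ([m+n]%n≡m%n s n) (cong (_% n) (sym (ℕ.+-identityʳ s)))) ⟩
  ∑[ i < n ] g (toℕ i) + g 0       ∎)) (sum-rotate n s f)
  where
  open ≡-Reasoning
  g : ℕ → ℕ
  g t = f ((s + t) % n)

sum-≤? : ∀ e r → ∑[ i < e + r ] [ does (e ℕ.≤? toℕ i) ] ≡ r
sum-≤? zero    r = trans (sum-const r 1) (ℕ.*-identityʳ r)
sum-≤? (suc e) r = trans (sum-cong-≗ {e + r} λ i → cong [_] (≤?-suc e (toℕ i))) (sum-≤? e r)
  where
  ≤?-suc : ∀ e i → does (suc e ℕ.≤? suc i) ≡ does (e ℕ.≤? i)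
  ≤?-suc zero    i = refl
  ≤?-suc (suc e) i = refl

∣∣-sum : ∀ {n} (S : Subset n) → Subset.∣ S ∣ ≡ ∑[ i < n ] [ lookup S i ]
∣∣-sum []          = refl
∣∣-sum (true  ∷ S) = cong suc (∣∣-sum S)
∣∣-sum (false ∷ S) = ∣∣-sum S

does-∈? : ∀ {n} (x : Fin n) S → does (x ∈? S) ≡ lookup S x
does-∈? zero    (true  ∷ S) = refl
does-∈? zero    (false ∷ S) = refl
does-∈? (suc x) (_     ∷ S) with x ∈? S | does-∈? x S
... | yes _ | eq = eq
... | no  _ | eq = eq

-- Natural numbers inside the rationals, and rational sums.

ι : ℕ → ℚ
ι n = ℤ.+ n ℚ./ 1

-- Sums and products of values of `ι` are compared as unnormalised fractions, where cancelling
-- common factors does not interfere and integer arithmetic suffices.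
toℚᵘ-ι : ∀ n → ℚ.toℚᵘ (ι n) ℚᵘ.≃ ℚᵘ.mkℚᵘ (ℤ.+ n) 0
toℚᵘ-ι n = ℚ.toℚᵘ-fromℚᵘ (ℚᵘ.mkℚᵘ (ℤ.+ n) 0)

ι-+ : ∀ m n → ι (m + n) ≡ ι m ℚ.+ ι n
ι-+ m n = ℚ.toℚᵘ-injective (begin
  ℚ.toℚᵘ (ι (m + n))                     ≈⟨ toℚᵘ-ι (m + n) ⟩
  ℚᵘ.mkℚᵘ (ℤ.+ (m + n)) 0                ≈⟨ ℚᵘ.*≡* (cong (ℤ._* ℤ.1ℤ) (sym (cong₂ ℤ._+_
                                                 (ℤ.*-identityʳ (ℤ.+ m)) (ℤ.*-identityʳ (ℤ.+ n))))) ⟩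
  ℚᵘ.mkℚᵘ (ℤ.+ m) 0 ℚᵘ.+ ℚᵘ.mkℚᵘ (ℤ.+ n) 0 ≈⟨ ℚᵘ.≃-sym (ℚᵘ.+-cong (toℚᵘ-ι m) (toℚᵘ-ι n)) ⟩
  ℚ.toℚᵘ (ι m) ℚᵘ.+ ℚ.toℚᵘ (ι n)         ≈⟨ ℚᵘ.≃-sym (ℚ.toℚᵘ-homo-+ (ι m) (ι n)) ⟩
  ℚ.toℚᵘ (ι m ℚ.+ ι n)                   ∎)
  where open ℚᵘ.≃-Reasoning

ι-* : ∀ m n → ι (m * n) ≡ ι m ℚ.* ι n
ι-* m n = ℚ.toℚᵘ-injective (begin
  ℚ.toℚᵘ (ι (m * n))                     ≈⟨ toℚᵘ-ι (m * n) ⟩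
  ℚᵘ.mkℚᵘ (ℤ.+ (m * n)) 0                ≈⟨ ℚᵘ.*≡* (cong (ℤ._* ℤ.1ℤ) (ℤ.pos-* m n)) ⟩
  ℚᵘ.mkℚᵘ (ℤ.+ m) 0 ℚᵘ.* ℚᵘ.mkℚᵘ (ℤ.+ n) 0 ≈⟨ ℚᵘ.≃-sym (ℚᵘ.*-cong (toℚᵘ-ι m) (toℚᵘ-ι n)) ⟩
  ℚ.toℚᵘ (ι m) ℚᵘ.* ℚ.toℚᵘ (ι n)         ≈⟨ ℚᵘ.≃-sym (ℚ.toℚᵘ-homo-* (ι m) (ι n)) ⟩
  ℚ.toℚᵘ (ι m ℚ.* ι n)                   ∎)
  where open ℚᵘ.≃-Reasoning

0≤ι : ∀ n → 0ℚ ℚ.≤ ι n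
0≤ι n = ℚ.nonNegative⁻¹ (ι n) {{ℚ.normalize-nonNeg n 1}}

0<ι : ∀ n → 0ℚ ℚ.< ι (suc n)
0<ι n = ℚ.positive⁻¹ (ι (suc n)) {{ℚ.normalize-pos (suc n) 1}}

ι-mono : ∀ {m n} → m ≤ n → ι m ℚ.≤ ι n
ι-mono {m} {n} m≤n = subst₂ ℚ._≤_ (ℚ.+-identityʳ (ι m))
  (trans (sym (ι-+ m (n ℕ.∸ m))) (cong ι (ℕ.m+[n∸m]≡n m≤n)))
  (ℚ.+-monoʳ-≤ (ι m) (0≤ι (n ℕ.∸ m)))

ι-mono-< : ∀ {m n} → m < n → ι m ℚ.< ι n
ι-mono-< {m} {n} m<n = ℚ.<-≤-trans
  (subst₂ ℚ._<_ (ℚ.+-identityˡ (ι m)) (sym (ι-+ 1 m)) (ℚ.+-monoˡ-< (ι m) (0<ι 0)))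
  (ι-mono m<n)

abstract
  -- The reciprocal of `n + 1`, hence a total function. Being abstract, it enters later identities
  -- only through its sign and the inverse law.
  ι⁻¹ : ℕ → ℚ
  ι⁻¹ n = (ℚ.1/ ι (suc n)) {{ℚ.>-nonZero (0<ι n)}}

  ι⁻¹>0 : ∀ n → 0ℚ ℚ.< ι⁻¹ n
  ι⁻¹>0 n = ℚ.positive⁻¹ _ {{ℚ.1/pos⇒pos (ι (suc n)) {{ℚ.positive (0<ι n)}}}}

  ι⁻¹-inverseˡ : ∀ n → ι⁻¹ n ℚ.* ι (suc n) ≡ 1ℚ
  ι⁻¹-inverseˡ n = ℚ.*-inverseˡ (ι (suc n)) {{ℚ.>-nonZero (0<ι n)}}

ι-sum : ∀ {n} (f : Fin n → ℕ) → ι (sum f) ≡ sumℚ (ι ∘ f)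
ι-sum {zero}  f = refl
ι-sum {suc n} f = trans (ι-+ (f zero) _) (cong (ι (f zero) ℚ.+_) (ι-sum (f ∘ suc)))

sumℚ-mono : ∀ {n} {f g : Fin n → ℚ} → (∀ i → f i ℚ.≤ g i) → sumℚ f ℚ.≤ sumℚ g
sumℚ-mono {zero}  f≤g = ℚ.≤-refl
sumℚ-mono {suc n} f≤g = ℚ.+-mono-≤ (f≤g zero) (sumℚ-mono (f≤g ∘ suc))

sumL : List ℚ → ℚ
sumL = List.foldr ℚ._+_ 0ℚ

-- Pairs are ordered, so each edge is counted twice, in the totals over the graph as well as on
-- single copies.
Σ² : ∀ {n} → (Fin n → Fin n → ℕ) → ℕ
Σ² f = sum λ x → sum (f x)

Σ²ℚ : ∀ {n} → (Fin n → Fin n → ℚ) → ℚ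
Σ²ℚ f = sumℚ λ x → sumℚ (f x)

Σ²ℚ-cong : ∀ {n} {f g : Fin n → Fin n → ℚ} → (∀ x y → f x y ≡ g x y) → Σ²ℚ f ≡ Σ²ℚ g
Σ²ℚ-cong f≗g = sumℚ-cong λ x → sumℚ-cong (f≗g x)

Σ²ℚ-mono : ∀ {n} {f g : Fin n → Fin n → ℚ} → (∀ x y → f x y ℚ.≤ g x y) → Σ²ℚ f ℚ.≤ Σ²ℚ g
Σ²ℚ-mono f≤g = sumℚ-mono λ x → sumℚ-mono (f≤g x)

Σ²ℚ-0 : ∀ n → Σ²ℚ {n} (λ _ _ → 0ℚ) ≡ 0ℚ
Σ²ℚ-0 n = trans (sumℚ-cong {n} λ _ → sumℚ-0 n) (sumℚ-0 n)

Σ²ℚ-+ : ∀ {n} (f g : Fin n → Fin n → ℚ) → Σ²ℚ (λ x y → f x y ℚ.+ g x y) ≡ Σ²ℚ f ℚ.+ Σ²ℚ g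
Σ²ℚ-+ f g = trans (sumℚ-cong λ x → sumℚ-+ (f x) (g x)) (sumℚ-+ (sumℚ ∘ f) (sumℚ ∘ g))

*-distribˡ-Σ²ℚ : ∀ {n} c (f : Fin n → Fin n → ℚ) → c ℚ.* Σ²ℚ f ≡ Σ²ℚ (λ x y → c ℚ.* f x y)
*-distribˡ-Σ²ℚ c f = trans (*-distribˡ-sumℚ c (sumℚ ∘ f)) (sumℚ-cong λ x → *-distribˡ-sumℚ c (f x))

ι-Σ² : ∀ {n} (f : Fin n → Fin n → ℕ) → ι (Σ² f) ≡ Σ²ℚ (λ x y → ι (f x y))
ι-Σ² f = trans (ι-sum (sum ∘ f)) (sumℚ-cong λ x → ι-sum (f x))

ι-*-Σ² : ∀ {n} c (f : Fin n → Fin n → ℕ) → Σ²ℚ (λ x y → c ℚ.* ι (f x y)) ≡ c ℚ.* ι (Σ² f)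
ι-*-Σ² c f = trans (sym (*-distribˡ-Σ²ℚ c λ x y → ι (f x y))) (cong (c ℚ.*_) (sym (ι-Σ² f)))

Σ²ℚ-affine : ∀ {n} c (f : Fin n → Fin n → ℕ) →
             Σ²ℚ (λ x y → ι (f x y) ℚ.+ c ℚ.* ι (f x y)) ≡ ι (Σ² f) ℚ.+ c ℚ.* ι (Σ² f)
Σ²ℚ-affine c f = trans (Σ²ℚ-+ (λ x y → ι (f x y)) (λ x y → c ℚ.* ι (f x y)))
                       (cong₂ ℚ._+_ (sym (ι-Σ² f)) (ι-*-Σ² c f))

-- Absolute values and properties that hold from some index on.

p≤∣p∣ : ∀ p → p ℚ.≤ ℚ.∣ p ∣
p≤∣p∣ p with ℚ.≤-total 0ℚ p
... | inj₁ 0≤p = ℚ.≤-reflexive (sym (ℚ.0≤p⇒∣p∣≡p 0≤p))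
... | inj₂ p≤0 = ℚ.≤-trans p≤0 (ℚ.0≤∣p∣ p)

∣-∣<⇒near : ∀ {p q η} → ℚ.∣ p ℚ.- q ∣ ℚ.< η → q ℚ.≤ p ℚ.+ η × p ℚ.≤ q ℚ.+ η
∣-∣<⇒near {p} {q} {η} h = lower , upper
  where
  open ℚ.≤-Reasoning
  open ℚ.+-*-Solver using (solve; _:+_; _:-_; :-_; _:=_)
  lower : q ℚ.≤ p ℚ.+ η
  lower = begin
    q                          ≡⟨ solve 2 (λ p q → q := p :+ (:- (p :- q))) refl p q ⟩
    p ℚ.+ ℚ.- (p ℚ.- q)        ≤⟨ ℚ.+-monoʳ-≤ p (p≤∣p∣ (ℚ.- (p ℚ.- q))) ⟩
    p ℚ.+ ℚ.∣ ℚ.- (p ℚ.- q) ∣  ≡⟨ cong (p ℚ.+_) (ℚ.∣-p∣≡∣p∣ (p ℚ.- q)) ⟩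
    p ℚ.+ ℚ.∣ p ℚ.- q ∣        ≤⟨ ℚ.+-monoʳ-≤ p (ℚ.<⇒≤ h) ⟩
    p ℚ.+ η                    ∎
  upper : p ℚ.≤ q ℚ.+ η
  upper = begin
    p                          ≡⟨ solve 2 (λ p q → p := q :+ (p :- q)) refl p q ⟩
    q ℚ.+ (p ℚ.- q)            ≤⟨ ℚ.+-monoʳ-≤ q (p≤∣p∣ (p ℚ.- q)) ⟩
    q ℚ.+ ℚ.∣ p ℚ.- q ∣        ≤⟨ ℚ.+-monoʳ-≤ q (ℚ.<⇒≤ h) ⟩
    q ℚ.+ η                    ∎

-- Order and equality of reals yield rational estimates from some index on. Finitely many of them
-- hold at a common index, and there real weights can be replaced by rational ones.
Eventually : (ℕ → Set) → Set
Eventually P = ∃[ N ] (∀ n → N ≤ n → P n)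

eventually-× : ∀ {P Q} → Eventually P → Eventually Q → Eventually (λ n → P n × Q n)
eventually-× (M , f) (N , g) = M ℕ.⊔ N , λ n K≤n →
  f n (ℕ.m⊔n≤o⇒m≤o M N K≤n) , g n (ℕ.m⊔n≤o⇒n≤o M N K≤n)

eventually-All : ∀ {A : Set} {P : A → ℕ → Set} {xs} →
                 All (λ x → Eventually (P x)) xs → Eventually (λ n → All (λ x → P x n) xs)
eventually-All []       = 0 , λ _ _ → []
eventually-All (e ∷ es) = map₂ (λ h n N≤n → uncurry _∷_ (h n N≤n))
                               (eventually-× e (eventually-All es))

eventually-Fin : ∀ {m} {P : Fin m → ℕ → Set} →
                 (∀ i → Eventually (P i)) → Eventually (λ n → ∀ i → P i n)
eventually-Fin es = map₂ (λ h n N≤n i → All.lookup (h n N≤n) (∈-allFin i))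
  (eventually-All (All.universal es (List.allFin _)))

-- The duality obstruction to decompositions.

inner : ∀ {v} → (Fin v → Fin v → ℕ) → Subset v → ℕ
inner κ S = Σ² λ x y → [ lookup S x ] * [ lookup S y ] * κ x y

-- LP duality: an edge weighting κ⁺ - κ⁻ that is nonnegative on every copy of
-- K_q but negative in total rules out a (fractional) decomposition.
module Obstruction
  (q : ℕ) (G : Graph) (κ⁺ κ⁻ : Fin (Graph.v G) → Fin (Graph.v G) → ℕ)
  (supp⁺ : ∀ x y → ¬ Graph._~_ G x y → κ⁺ x y ≡ 0)
  (supp⁻ : ∀ x y → ¬ Graph._~_ G x y → κ⁻ x y ≡ 0)
  (copy≥0 : ∀ S → Decompositions.IsCopy q G S → inner κ⁻ S ≤ inner κ⁺ S)
  (total<0 : Σ² κ⁺ < Σ² κ⁻)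
  where

  open Graph G
  open Decompositions q G hiding (Decomposition; FractionalDecomposition)

  -- The total weight that the sets in `L` put on a pair. Taking `copies` for `L` gives the
  -- fractional case, the parts with constant weight 1 the integral one.
  load : List (Subset v) → (Subset v → ℚ) → Fin v → Fin v → ℚ
  load L w x y = sumL (List.map w (filter (contains? x y) L))

  load-∷ : ∀ S L w x y →
           load (S ∷ L) w x y ≡ ι ([ lookup S x ] * [ lookup S y ]) ℚ.* w S ℚ.+ load L w x y
  load-∷ S L w x y with x ∈? S | does-∈? x S | y ∈? S | does-∈? y S
  ... | yes p | ex | yes r | ey = cong (ℚ._+ _) (sym (trans
          (cong₂ (λ s t → ι ([ s ] * [ t ]) ℚ.* w S) (sym ex) (sym ey)) (ℚ.*-identityˡ (w S))))
  ... | yes p | ex | no ¬r | ey = sym (trans (cong (ℚ._+ _) (trans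
          (cong₂ (λ s t → ι ([ s ] * [ t ]) ℚ.* w S) (sym ex) (sym ey))
          (ℚ.*-zeroˡ (w S)))) (ℚ.+-identityˡ _))
  ... | no ¬p | ex | _     | ey = sym (trans (cong (ℚ._+ _) (trans
          (cong (λ s → ι ([ s ] * [ lookup S y ]) ℚ.* w S) (sym ex))
          (ℚ.*-zeroˡ (w S)))) (ℚ.+-identityˡ _))

  weigh : (Subset v → ℚ) → (Fin v → Fin v → ℕ) → List (Subset v) → ℚ
  weigh w κ L = sumL (List.map (λ S → w S ℚ.* ι (inner κ S)) L)

  -- Both sides add up `w S * κ x y` over all `S` in `L` and all ordered pairs of vertices of `S`,
  -- once copy by copy and once pair by pair.
  double-counting : ∀ w κ L → weigh w κ L ≡ Σ²ℚ (λ x y → ι (κ x y) ℚ.* load L w x y)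
  double-counting w κ []      = sym (trans (Σ²ℚ-cong λ x y → ℚ.*-zeroʳ (ι (κ x y))) (Σ²ℚ-0 v))
  double-counting w κ (S ∷ L) = sym (begin
    Σ²ℚ (λ x y → ι (κ x y) ℚ.* load (S ∷ L) w x y)
      ≡⟨ Σ²ℚ-cong (λ x y → trans (cong (ι (κ x y) ℚ.*_) (load-∷ S L w x y)) (expand x y)) ⟩
    Σ²ℚ (λ x y → w S ℚ.* ι (g x y * κ x y) ℚ.+ ι (κ x y) ℚ.* load L w x y)
      ≡⟨ Σ²ℚ-+ (λ x y → w S ℚ.* ι (g x y * κ x y)) (λ x y → ι (κ x y) ℚ.* load L w x y) ⟩
    Σ²ℚ (λ x y → w S ℚ.* ι (g x y * κ x y)) ℚ.+ Σ²ℚ (λ x y → ι (κ x y) ℚ.* load L w x y)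
      ≡⟨ cong₂ ℚ._+_ (trans (sym (*-distribˡ-Σ²ℚ (w S) λ x y → ι (g x y * κ x y)))
                            (cong (w S ℚ.*_) (sym (ι-Σ² λ x y → g x y * κ x y))))
                     (sym (double-counting w κ L)) ⟩
    weigh w κ (S ∷ L) ∎)
    where
    open ≡-Reasoning
    open ℚ.+-*-Solver using (solve; _:+_; _:*_; _:=_)
    g : Fin v → Fin v → ℕ
    g x y = [ lookup S x ] * [ lookup S y ]
    expand : ∀ x y → ι (κ x y) ℚ.* (ι (g x y) ℚ.* w S ℚ.+ load L w x y) ≡
                     w S ℚ.* ι (g x y * κ x y) ℚ.+ ι (κ x y) ℚ.* load L w x y
    expand x y = trans
      (solve 4 (λ k g w l → k :* (g :* w :+ l) := w :* (g :* k) :+ k :* l) refl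
        (ι (κ x y)) (ι (g x y)) (w S) (load L w x y))
      (cong (λ t → w S ℚ.* t ℚ.+ ι (κ x y) ℚ.* load L w x y) (sym (ι-* (g x y) (κ x y))))

  total⁺ : List (Subset v) → ℕ
  total⁺ []      = 0
  total⁺ (S ∷ L) = inner κ⁺ S + total⁺ L

  -- A weight may be as low as `- η`, so `copy≥0` is multiplied by the nonnegative `w S + η` instead
  -- of `w S`. Each copy then costs an error of `η * inner κ⁺ S`, which `total⁺` collects.
  weigh⁻≤weigh⁺ : ∀ w η → 0ℚ ℚ.≤ η → ∀ L → All IsCopy L → All (λ S → 0ℚ ℚ.≤ w S ℚ.+ η) L →
                  weigh w κ⁻ L ℚ.≤ weigh w κ⁺ L ℚ.+ η ℚ.* ι (total⁺ L)
  weigh⁻≤weigh⁺ w η 0≤η []      []       []       = ℚ.≤-reflexive (sym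
    (trans (cong (0ℚ ℚ.+_) (ℚ.*-zeroʳ η)) (ℚ.+-identityˡ 0ℚ)))
  weigh⁻≤weigh⁺ w η 0≤η (S ∷ L) (c ∷ cs) (p ∷ ps) = begin
    w S ℚ.* n ℚ.+ weigh w κ⁻ L
      ≤⟨ ℚ.+-mono-≤ head (weigh⁻≤weigh⁺ w η 0≤η L cs ps) ⟩
    (w S ℚ.* m ℚ.+ η ℚ.* m) ℚ.+ (weigh w κ⁺ L ℚ.+ η ℚ.* ι (total⁺ L))
      ≡⟨ solve 5 (λ w m e r t →
             (w :* m :+ e :* m) :+ (r :+ e :* t) := (w :* m :+ r) :+ e :* (m :+ t))
           refl (w S) m η (weigh w κ⁺ L) (ι (total⁺ L)) ⟩
    weigh w κ⁺ (S ∷ L) ℚ.+ η ℚ.* (m ℚ.+ ι (total⁺ L))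
      ≡⟨ cong (λ t → weigh w κ⁺ (S ∷ L) ℚ.+ η ℚ.* t) (sym (ι-+ (inner κ⁺ S) (total⁺ L))) ⟩
    weigh w κ⁺ (S ∷ L) ℚ.+ η ℚ.* ι (total⁺ (S ∷ L)) ∎
    where
    open ℚ.≤-Reasoning
    open ℚ.+-*-Solver using (solve; _:+_; _:*_; _:=_)
    m n : ℚ
    m = ι (inner κ⁺ S)
    n = ι (inner κ⁻ S)
    head : w S ℚ.* n ℚ.≤ w S ℚ.* m ℚ.+ η ℚ.* m
    head = begin
      w S ℚ.* n
        ≡⟨ sym (ℚ.+-identityʳ _) ⟩
      w S ℚ.* n ℚ.+ 0ℚ
        ≤⟨ ℚ.+-monoʳ-≤ (w S ℚ.* n) (subst (ℚ._≤ η ℚ.* n) (ℚ.*-zeroʳ η)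
             (ℚ.*-monoˡ-≤-nonNeg η {{ℚ.nonNegative 0≤η}} (0≤ι (inner κ⁻ S)))) ⟩
      w S ℚ.* n ℚ.+ η ℚ.* n
        ≡⟨ sym (ℚ.*-distribʳ-+ n (w S) η) ⟩
      (w S ℚ.+ η) ℚ.* n
        ≤⟨ ℚ.*-monoˡ-≤-nonNeg (w S ℚ.+ η) {{ℚ.nonNegative p}} (ι-mono (copy≥0 S c)) ⟩
      (w S ℚ.+ η) ℚ.* m
        ≡⟨ ℚ.*-distribʳ-+ m (w S) η ⟩
      w S ℚ.* m ℚ.+ η ℚ.* m ∎

  -- The coefficient of `η` in the accumulated error: one term each for the lower and upper bounds
  -- on the loads, and one for weights that are only at least `- η`.
  slack : List (Subset v) → ℕ
  slack L = Σ² κ⁻ + (Σ² κ⁺ + total⁺ L)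

  weigh⁺≤ : ∀ w η L → (∀ x y → x ~ y → load L w x y ℚ.≤ 1ℚ ℚ.+ η) →
            weigh w κ⁺ L ℚ.≤ ι (Σ² κ⁺) ℚ.+ η ℚ.* ι (Σ² κ⁺)
  weigh⁺≤ w η L load≤ = begin
    weigh w κ⁺ L                                      ≡⟨ double-counting w κ⁺ L ⟩
    Σ²ℚ (λ x y → ι (κ⁺ x y) ℚ.* load L w x y)         ≤⟨ Σ²ℚ-mono term ⟩
    Σ²ℚ (λ x y → ι (κ⁺ x y) ℚ.+ η ℚ.* ι (κ⁺ x y))     ≡⟨ Σ²ℚ-affine η κ⁺ ⟩
    ι (Σ² κ⁺) ℚ.+ η ℚ.* ι (Σ² κ⁺)                     ∎
    where
    open ℚ.≤-Reasoning
    open ℚ.+-*-Solver using (solve; _:+_; _:*_; _:=_; con)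
    term : ∀ x y → ι (κ⁺ x y) ℚ.* load L w x y ℚ.≤ ι (κ⁺ x y) ℚ.+ η ℚ.* ι (κ⁺ x y)
    term x y with x ~? y
    ... | yes x~y = ℚ.≤-trans
      (ℚ.*-monoˡ-≤-nonNeg (ι (κ⁺ x y)) {{ℚ.nonNegative (0≤ι (κ⁺ x y))}} (load≤ x y x~y))
      (ℚ.≤-reflexive (solve 2 (λ k e → k :* (con 1ℚ :+ e) := k :+ e :* k) refl (ι (κ⁺ x y)) η))
    ... | no x≁y rewrite supp⁺ x y x≁y = ℚ.≤-reflexive
      (trans (ℚ.*-zeroˡ (load L w x y)) (sym (trans (ℚ.+-identityˡ _) (ℚ.*-zeroʳ η))))

  weigh⁻≥ : ∀ w η L → (∀ x y → x ~ y → 1ℚ ℚ.≤ load L w x y ℚ.+ η) →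
            ι (Σ² κ⁻) ℚ.≤ weigh w κ⁻ L ℚ.+ η ℚ.* ι (Σ² κ⁻)
  weigh⁻≥ w η L ≤load = begin
    ι (Σ² κ⁻)                                             ≡⟨ ι-Σ² κ⁻ ⟩
    Σ²ℚ (λ x y → ι (κ⁻ x y))                              ≤⟨ Σ²ℚ-mono term ⟩
    Σ²ℚ (λ x y → ι (κ⁻ x y) ℚ.* load L w x y ℚ.+ η ℚ.* ι (κ⁻ x y))
      ≡⟨ Σ²ℚ-+ (λ x y → ι (κ⁻ x y) ℚ.* load L w x y) (λ x y → η ℚ.* ι (κ⁻ x y)) ⟩
    Σ²ℚ (λ x y → ι (κ⁻ x y) ℚ.* load L w x y) ℚ.+ Σ²ℚ (λ x y → η ℚ.* ι (κ⁻ x y))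
      ≡⟨ cong₂ ℚ._+_ (sym (double-counting w κ⁻ L)) (ι-*-Σ² η κ⁻) ⟩
    weigh w κ⁻ L ℚ.+ η ℚ.* ι (Σ² κ⁻)                      ∎
    where
    open ℚ.≤-Reasoning
    open ℚ.+-*-Solver using (solve; _:+_; _:*_; _:=_)
    term : ∀ x y → ι (κ⁻ x y) ℚ.≤ ι (κ⁻ x y) ℚ.* load L w x y ℚ.+ η ℚ.* ι (κ⁻ x y)
    term x y with x ~? y
    ... | yes x~y = begin
      ι (κ⁻ x y)
        ≡⟨ sym (ℚ.*-identityʳ _) ⟩
      ι (κ⁻ x y) ℚ.* 1ℚ
        ≤⟨ ℚ.*-monoˡ-≤-nonNeg (ι (κ⁻ x y)) {{ℚ.nonNegative (0≤ι (κ⁻ x y))}} (≤load x y x~y) ⟩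
      ι (κ⁻ x y) ℚ.* (load L w x y ℚ.+ η)
        ≡⟨ solve 3 (λ k l e → k :* (l :+ e) := k :* l :+ e :* k) refl (ι (κ⁻ x y)) (load L w x y) η ⟩
      ι (κ⁻ x y) ℚ.* load L w x y ℚ.+ η ℚ.* ι (κ⁻ x y) ∎
    ... | no x≁y rewrite supp⁻ x y x≁y = ℚ.≤-reflexive
      (sym (trans (cong₂ ℚ._+_ (ℚ.*-zeroˡ (load L w x y)) (ℚ.*-zeroʳ η)) (ℚ.+-identityˡ 0ℚ)))

  -- The two totals of the weighting are natural numbers, so `total<0` separates them by at least 1.
  -- An approximate decomposition with error `η` would bring them within `η * slack L`, which is
  -- less than 1 for the chosen `η`.
  no-approximation : ∀ L w → let η = ι⁻¹ (slack L) in
    All IsCopy L → All (λ S → 0ℚ ℚ.≤ w S ℚ.+ η) L →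
    ¬ (∀ x y → x ~ y → 1ℚ ℚ.≤ load L w x y ℚ.+ η × load L w x y ℚ.≤ 1ℚ ℚ.+ η)
  no-approximation L w cs w≥ near = ℚ.<-irrefl refl (begin-strict
    n
      ≤⟨ weigh⁻≥ w η L (λ x y x~y → proj₁ (near x y x~y)) ⟩
    weigh w κ⁻ L ℚ.+ η ℚ.* n
      ≤⟨ ℚ.+-monoˡ-≤ (η ℚ.* n) (weigh⁻≤weigh⁺ w η (ℚ.<⇒≤ (ι⁻¹>0 (slack L))) L cs w≥) ⟩
    weigh w κ⁺ L ℚ.+ η ℚ.* t ℚ.+ η ℚ.* n
      ≤⟨ ℚ.+-monoˡ-≤ (η ℚ.* n) (ℚ.+-monoˡ-≤ (η ℚ.* t)
           (weigh⁺≤ w η L λ x y x~y → proj₂ (near x y x~y))) ⟩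
    p ℚ.+ η ℚ.* p ℚ.+ η ℚ.* t ℚ.+ η ℚ.* n
      ≡⟨ solve 4 (λ p e t n → ((p :+ e :* p) :+ e :* t) :+ e :* n := p :+ e :* (n :+ (p :+ t)))
           refl p η t n ⟩
    p ℚ.+ η ℚ.* (n ℚ.+ (p ℚ.+ t))
      ≡⟨ cong (λ s → p ℚ.+ η ℚ.* s) (sym (trans (ι-+ (Σ² κ⁻) _)
           (cong (n ℚ.+_) (ι-+ (Σ² κ⁺) (total⁺ L))))) ⟩
    p ℚ.+ η ℚ.* ι (slack L)
      <⟨ ℚ.+-monoʳ-< p (ℚ.*-monoʳ-<-pos η {{ℚ.positive (ι⁻¹>0 (slack L))}}
           (ι-mono-< (ℕ.n<1+n (slack L)))) ⟩
    p ℚ.+ η ℚ.* ι (suc (slack L))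
      ≡⟨ cong (p ℚ.+_) (ι⁻¹-inverseˡ (slack L)) ⟩
    p ℚ.+ 1ℚ
      ≡⟨ ℚ.+-comm p 1ℚ ⟩
    1ℚ ℚ.+ p
      ≡⟨ sym (ι-+ 1 (Σ² κ⁺)) ⟩
    ι (suc (Σ² κ⁺))
      ≤⟨ ι-mono total<0 ⟩
    n ∎)
    where
    open ℚ.≤-Reasoning
    open ℚ.+-*-Solver using (solve; _:+_; _:*_; _:=_)
    η n p t : ℚ
    η = ι⁻¹ (slack L)
    n = ι (Σ² κ⁻)
    p = ι (Σ² κ⁺)
    t = ι (total⁺ L)

  -- Once a part contains the edge, edge-disjointness keeps all later parts from containing it, so
  -- exactly one term survives.
  load-single : ∀ L x y → AllPairs EdgeDisjoint L → x ~ y → Any (Contains x y) L →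
                load L (λ _ → 1ℚ) x y ≡ 1ℚ
  load-single (S ∷ L) x y (S#L ∷ dis) x~y i with contains? x y S
  ... | yes S∋xy = begin
    load (S ∷ L) one x y
      ≡⟨ cong (sumL ∘ List.map one) (List.filter-accept (contains? x y) S∋xy) ⟩
    1ℚ ℚ.+ load L one x y
      ≡⟨ cong (λ l → 1ℚ ℚ.+ sumL (List.map one l)) (List.filter-none (contains? x y)
           (All.map (λ S#T T∋xy → S#T x y x~y (S∋xy , T∋xy)) S#L)) ⟩
    1ℚ ℚ.+ 0ℚ
      ≡⟨ ℚ.+-identityʳ 1ℚ ⟩
    1ℚ ∎
    where
    open ≡-Reasoning
    one : Subset v → ℚ
    one _ = 1ℚ
  ... | no S∌xy = trans
    (cong (λ l → sumL (List.map (λ _ → 1ℚ) l)) (List.filter-reject (contains? x y) S∌xy))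
    (load-single L x y dis x~y (Any.tail S∌xy i))

  no-decomposition : ¬ Decomposition q G
  no-decomposition D = no-approximation parts (λ _ → 1ℚ) areCopy
    (All.universal (λ _ → ℚ.≤-trans (ℚ.<⇒≤ (0<ι 0)) 1≤1+η) parts)
    λ x y x~y → let l≡1 = load-single parts x y disjoint x~y (covers x y x~y) in
      subst (λ l → 1ℚ ℚ.≤ l ℚ.+ η) (sym l≡1) 1≤1+η , subst (ℚ._≤ 1ℚ ℚ.+ η) (sym l≡1) 1≤1+η
    where
    open Decomposition D
    η : ℚ
    η = ι⁻¹ (slack parts)
    1≤1+η : 1ℚ ℚ.≤ 1ℚ ℚ.+ η
    1≤1+η = subst (ℚ._≤ 1ℚ ℚ.+ η) (ℚ.+-identityʳ 1ℚ) (ℚ.+-monoʳ-≤ 1ℚ (ℚ.<⇒≤ (ι⁻¹>0 (slack parts))))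

  seq-sumℝ : ∀ n (W : Subset v → ℝ) L →
             seq (sumℝ (List.map W L)) n ≡ sumL (List.map (λ S → seq (W S) n) L)
  seq-sumℝ n W []      = refl
  seq-sumℝ n W (S ∷ L) = cong (seq (W S) n ℚ.+_) (seq-sumℝ n W L)

  no-fractional : ¬ FractionalDecomposition q G
  no-fractional D = no-approximation copies w copies-areCopy (proj₁ (at-N ℕ.≤-refl)) near
    where
    open FractionalDecomposition D
    η : ℚ
    η = ι⁻¹ (slack copies)
    0<η : 0ℚ ℚ.< η
    0<η = ι⁻¹>0 (slack copies)
    copies-areCopy : All IsCopy copies
    copies-areCopy = All.all-filter isCopy? (subsets v)
    sum-at : ℕ → Fin v → Fin v → ℚ
    sum-at n x y = seq (sumℝ (List.map weight (filter (contains? x y) copies))) n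
    eventually-near : ∀ x y → Eventually λ n → x ~ y → ℚ.∣ sum-at n x y ℚ.- 1ℚ ∣ ℚ.< η
    -- The hypothesis `total` covers adjacent pairs only. Deciding adjacency first provides an index
    -- for every pair, as a common index for all pairs requires.
    eventually-near x y with x ~? y
    ... | yes x~y = map₂ (λ h n N≤n _ → h n N≤n) (total x y x~y η 0<η)
    ... | no x≁y  = 0 , λ _ _ x~y → contradiction x~y x≁y
    eventually : Eventually λ n →
      All (λ S → 0ℚ ℚ.≤ seq (weight S) n ℚ.+ η) copies ×
      (∀ x y → x ~ y → ℚ.∣ sum-at n x y ℚ.- 1ℚ ∣ ℚ.< η)
    eventually = eventually-×
      (eventually-All (All.map (λ {S} S-copy → nonNeg S S-copy η 0<η) copies-areCopy))
      (eventually-Fin λ x → eventually-Fin λ y → eventually-near x y)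
    N : ℕ
    N = proj₁ eventually
    at-N = proj₂ eventually N
    w : Subset v → ℚ
    w S = seq (weight S) N
    near : ∀ x y → x ~ y → 1ℚ ℚ.≤ load copies w x y ℚ.+ η × load copies w x y ℚ.≤ 1ℚ ℚ.+ η
    near x y x~y = ∣-∣<⇒near (subst (λ s → ℚ.∣ s ℚ.- 1ℚ ∣ ℚ.< η)
      (seq-sumℝ N weight (filter (contains? x y) copies)) (proj₂ (at-N ℕ.≤-refl) x y x~y))

-- Quadratic forms on cliques.

Σ²-cong : ∀ {n} {f g : Fin n → Fin n → ℕ} → (∀ x y → f x y ≡ g x y) → Σ² f ≡ Σ² g
Σ²-cong f≗g = sum-cong-≗ λ x → sum-cong-≗ (f≗g x)

Σ²-+ : ∀ {n} (f g : Fin n → Fin n → ℕ) → Σ² (λ x y → f x y + g x y) ≡ Σ² f + Σ² g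
Σ²-+ f g = trans (sum-cong-≗ λ x → ∑-distrib-+ (f x) (g x)) (∑-distrib-+ (sum ∘ f) (sum ∘ g))

-- Each product form factors into two single sums. This turns the weight of a clique into a
-- polynomial in its numbers of vertices in A and in B.
Σ²-bilinear : ∀ {n} c c′ (f f′ g g′ : Fin n → ℕ) →
              Σ² (λ x y → c * f x * f′ y + c′ * g x * g′ y) ≡
              c * sum f * sum f′ + c′ * sum g * sum g′
Σ²-bilinear c c′ f f′ g g′ = trans (Σ²-+ (λ x y → c * f x * f′ y) (λ x y → c′ * g x * g′ y))
  (cong₂ _+_ (term c f f′) (term c′ g g′))
  where
  term : ∀ c (f f′ : Fin _ → ℕ) → Σ² (λ x y → c * f x * f′ y) ≡ c * sum f * sum f′
  term c f f′ = trans (sum-*-sum (λ x → c * f x) f′) (cong (_* sum f′) (sym (*-distribˡ-sum c f)))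

module _ (G : Graph) where

  open Graph G

  adj : Fin v → Fin v → ℕ
  adj x y = [ does (x ~? y) ]

  adj-≁ : ∀ x y → ¬ (x ~ y) → adj x y ≡ 0
  adj-≁ x y x≁y = cong [_] (dec-false (x ~? y) x≁y)

  -- Distinct vertices of a copy are adjacent and no vertex is adjacent to itself, so removing the
  -- adjacency factor changes only the diagonal.
  inner-adj : ∀ {q} (κ : Fin v → Fin v → ℕ) S → Decompositions.IsCopy q G S →
              inner (λ x y → adj x y * κ x y) S + ∑[ x < v ] ([ lookup S x ] * κ x x) ≡ inner κ S
  inner-adj κ S (_ , complete) = begin
    inner (λ x y → adj x y * κ x y) S + ∑[ x < v ] ([ lookup S x ] * κ x x)
      ≡⟨ cong (inner (λ x y → adj x y * κ x y) S +_)
           (sum-cong-≗ λ x → sym (sum-≟ x λ y → [ lookup S x ] * κ x y)) ⟩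
    inner (λ x y → adj x y * κ x y) S +
    Σ² (λ x y → [ does (x Fin.≟ y) ] * ([ lookup S x ] * κ x y))
      ≡⟨ sym (Σ²-+ (λ x y → [ lookup S x ] * [ lookup S y ] * (adj x y * κ x y)) _) ⟩
    Σ² (λ x y → [ lookup S x ] * [ lookup S y ] * (adj x y * κ x y) +
                [ does (x Fin.≟ y) ] * ([ lookup S x ] * κ x y))
      ≡⟨ Σ²-cong pointwise ⟩
    inner κ S ∎
    where
    open ≡-Reasoning
    pointwise : ∀ x y →
      [ lookup S x ] * [ lookup S y ] * (adj x y * κ x y) +
      [ does (x Fin.≟ y) ] * ([ lookup S x ] * κ x y) ≡
      [ lookup S x ] * [ lookup S y ] * κ x y
    pointwise x y with x Fin.≟ y
    ... | yes refl rewrite adj-≁ x x ~-irrefl with lookup S x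
    ...   | true  = ℕ.+-identityʳ _
    ...   | false = refl
    pointwise x y | no x≢y with lookup S x in ex | lookup S y in ey
    ...   | false | _     = refl
    ...   | true  | false = refl
    ...   | true  | true  = trans (ℕ.+-identityʳ _) (cong (_+ 0) (trans
      (cong (λ t → [ t ] * κ x y) (dec-true (x ~? y)
        (complete x y (Vec.lookup⇒[]= x S ex) (Vec.lookup⇒[]= y S ey) x≢y)))
      (ℕ.*-identityˡ (κ x y))))

-- With q = c + 2, the difference of the two sides is q (q - 1) (x - 1) (x - 2).
clique-weight≥0 : ∀ c x y → x + y ≡ 2 + c →
  2 * c * x * y + (suc c * c * x + 2 * y) ≤ suc c * c * x * x + 2 * y * y
-- For `x` equal to 0, equal to 1 or at least 2, the product (x - 1) (x - 2) is 2, 0 or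
-- `(1 + x′) * x′` with x = 2 + x′, so no subtraction of natural numbers occurs.
clique-weight≥0 c 0 y refl = ℕ.m+n≤o⇒m≤o _ (ℕ.≤-reflexive
  (solve 1 (λ c → let y = con 2 :+ c in
    con 2 :* c :* con 0 :* y :+ ((con 1 :+ c) :* c :* con 0 :+ con 2 :* y) :+
      con 2 :* (con 2 :+ c) :* (con 1 :+ c) :=
    (con 1 :+ c) :* c :* con 0 :* con 0 :+ con 2 :* y :* y) refl c))
  where open ℕ.+-*-Solver using (solve; con; _:+_; _:*_; _:=_)
clique-weight≥0 c 1 y refl = ℕ.≤-reflexive
  (solve 1 (λ c → let y = con 1 :+ c in
    con 2 :* c :* con 1 :* y :+ ((con 1 :+ c) :* c :* con 1 :+ con 2 :* y) :=
    (con 1 :+ c) :* c :* con 1 :* con 1 :+ con 2 :* y :* y) refl c)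
  where open ℕ.+-*-Solver using (solve; con; _:+_; _:*_; _:=_)
clique-weight≥0 c (suc (suc x)) y refl = ℕ.m+n≤o⇒m≤o _ (ℕ.≤-reflexive
  (solve 2 (λ x′ y → let x = con 2 :+ x′ ; c = x′ :+ y in
    con 2 :* c :* x :* y :+ ((con 1 :+ c) :* c :* x :+ con 2 :* y) :+
      (con 2 :+ c) :* (con 1 :+ c) :* (con 1 :+ x′) :* x′ :=
    (con 1 :+ c) :* c :* x :* x :+ con 2 :* y :* y) refl x y))
  where open ℕ.+-*-Solver using (solve; con; _:+_; _:*_; _:=_)

-- The balanced graph, its degrees and its edge weighting.

module Construction (c e r₁ r₂ : ℕ) .{{_ : NonZero (e + r₁)}} .{{_ : NonZero (e + r₂)}} where

  -- Here `c` is the number of parts minus 2. A vertex misses `e` vertices of its own class in each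
  -- other part, and meets `r₁` of them in A or `r₂` in B; the class sizes are written as sums
  -- accordingly.
  q a b n : ℕ
  q = 2 + c
  a = e + r₁
  b = e + r₂
  n = a + b

  Side : Set
  Side = Fin a ⊎ Fin b

  -- Inside a class, the condition on `i + j` modulo the class size gives a regular relation. Using
  -- the sum rather than the difference makes it symmetric at once.
  Compatible : Side → Side → Set
  Compatible (inj₁ i) (inj₁ j) = e ≤ (toℕ i + toℕ j) % a
  Compatible (inj₁ i) (inj₂ j) = ⊤
  Compatible (inj₂ i) (inj₁ j) = ⊤
  Compatible (inj₂ i) (inj₂ j) = e ≤ (toℕ i + toℕ j) % b

  compatible? : Decidable Compatible
  compatible? (inj₁ i) (inj₁ j) = e ℕ.≤? (toℕ i + toℕ j) % a
  compatible? (inj₁ i) (inj₂ j) = yes tt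
  compatible? (inj₂ i) (inj₁ j) = yes tt
  compatible? (inj₂ i) (inj₂ j) = e ℕ.≤? (toℕ i + toℕ j) % b

  compatible-sym : Symmetric Compatible
  compatible-sym {inj₁ i} {inj₁ j} p = subst (λ s → e ≤ s % a) (ℕ.+-comm (toℕ i) (toℕ j)) p
  compatible-sym {inj₁ i} {inj₂ j} p = tt
  compatible-sym {inj₂ i} {inj₁ j} p = tt
  compatible-sym {inj₂ i} {inj₂ j} p = subst (λ s → e ≤ s % b) (ℕ.+-comm (toℕ i) (toℕ j)) p

  part : Fin (q * n) → Fin q
  part x = proj₁ (remQuot n x)

  side : Fin (q * n) → Side
  side x = splitAt a (proj₂ (remQuot {q} n x))

  graph : Graph
  graph = record
    { v        = q * n
    ; _~_      = λ x y → part x ≢ part y × Compatible (side x) (side y)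
    ; _~?_     = λ x y → ¬? (part x Fin.≟ part y) ×-dec compatible? (side x) (side y)
    ; ~-sym    = λ {x} {y} (i≢j , s~t) → ≢-sym i≢j , compatible-sym {side x} {side y} s~t
    ; ~-irrefl = λ (i≢i , _) → i≢i refl
    }

  open Graph graph

  V : Fin q → Subset (q * n)
  V j = tabulate λ x → does (j Fin.≟ part x)

  lookup-V : ∀ j x → lookup (V j) x ≡ does (j Fin.≟ part x)
  lookup-V j = Vec.lookup∘tabulate λ x → does (j Fin.≟ part x)

  ∈V⇒ : ∀ {x} j → x ∈ V j → j ≡ part x
  ∈V⇒ {x} j x∈V with j Fin.≟ part x | trans (sym (lookup-V j x)) (Vec.[]=⇒lookup x∈V)
  ... | yes j≡ | _ = j≡

  ∈V⇐ : ∀ {x} j → j ≡ part x → x ∈ V j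
  ∈V⇐ {x} j j≡ = Vec.lookup⇒[]= x (V j) (trans (lookup-V j x) (dec-true (j Fin.≟ part x) j≡))

  partiteGraph : PartiteGraph q
  partiteGraph = record
    { graph       = graph
    ; V           = V
    ; covering    = λ x → part x , ∈V⇐ (part x) refl
    ; disjoint    = λ {x} {i} {j} x∈Vi x∈Vj → trans (∈V⇒ i x∈Vi) (sym (∈V⇒ j x∈Vj))
    ; independent = λ j x∈V y∈V (≢ , _) → ≢ (trans (sym (∈V⇒ j x∈V)) (∈V⇒ j y∈V))
    }

  sumSide : (Side → ℕ) → ℕ
  sumSide g = sum (g ∘ inj₁) + sum (g ∘ inj₂)

  -- A vertex encodes a pair of a part and a position within it, so a summand that separates
  -- accordingly has a factoring sum.
  sum-vertices : ∀ f (g : Side → ℕ) → ∑[ x < q * n ] (f (part x) * g (side x)) ≡ sum f * sumSide g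
  sum-vertices f g = begin
    ∑[ x < q * n ] (f (part x) * g (side x))
      ≡⟨ sum-combine q n _ ⟩
    ∑[ i < q ] ∑[ p < n ] (f (part (combine i p)) * g (side (combine i p)))
      ≡⟨ sum-cong-≗ {q} (λ i → sum-cong-≗ λ p →
           cong (λ (j , t) → f j * g (splitAt a t)) (Fin.remQuot-combine i p)) ⟩
    ∑[ i < q ] ∑[ p < n ] (f i * g (splitAt a p))
      ≡⟨ sum-*-sum f (g ∘ splitAt a) ⟩
    sum f * sum (g ∘ splitAt a)
      ≡⟨ cong (sum f *_) (trans (sum-+ a b (g ∘ splitAt a))
           (cong₂ _+_ (sum-cong-≗ λ i → cong g (Fin.splitAt-↑ˡ a i b))
                      (sum-cong-≗ λ i → cong g (Fin.splitAt-↑ʳ a b i)))) ⟩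
    sum f * sumSide g ∎
    where open ≡-Reasoning

  compat : Side → Side → ℕ
  compat s t = [ does (compatible? s t) ]

  adj-split : ∀ x y → adj graph x y ≡
              [ not (does (part x Fin.≟ part y)) ] * compat (side x) (side y)
  adj-split x y = []-∧ (not (does (part x Fin.≟ part y))) _

  sum-compat₁ : ∀ i → ∑[ j < a ] compat (inj₁ i) (inj₁ j) ≡ r₁
  sum-compat₁ i = trans (sum-rotate a (toℕ i) λ t → [ does (e ℕ.≤? t) ]) (sum-≤? e r₁)

  sum-compat₂ : ∀ i → ∑[ j < b ] compat (inj₂ i) (inj₂ j) ≡ r₂
  sum-compat₂ i = trans (sum-rotate b (toℕ i) λ t → [ does (e ℕ.≤? t) ]) (sum-≤? e r₂)

  sum-1 : ∀ n → ∑[ i < n ] 1 ≡ n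
  sum-1 n = trans (sum-const n 1) (ℕ.*-identityʳ n)

  -- Vertices of A and of B lose the same number `e` in their own class and none in the other. This
  -- common value makes the graph partite-divisible and determines its degrees.
  sumSide-compat : ∀ s → sumSide (compat s) ≡ e + r₁ + r₂
  sumSide-compat (inj₁ i) = trans (cong₂ _+_ (sum-compat₁ i) (sum-1 b))
    (trans (sym (ℕ.+-assoc r₁ e r₂)) (cong (_+ r₂) (ℕ.+-comm r₁ e)))
  sumSide-compat (inj₂ i) = cong₂ _+_ (sum-1 a) (sum-compat₂ i)

  degree : ∀ x j → j ≢ part x → d x (V j) ≡ e + r₁ + r₂
  degree x j j≢ = begin
    d x (V j)
      ≡⟨ ∣∣-sum (neighbours x ∩ V j) ⟩
    ∑[ y < q * n ] [ lookup (neighbours x ∩ V j) y ]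
      ≡⟨ sum-cong-≗ (λ y → trans (cong [_] (trans (Vec.lookup-zipWith _∧_ y (neighbours x) (V j))
           (cong₂ _∧_ (Vec.lookup∘tabulate (λ z → does (x ~? z)) y)
                      (lookup-V j y))))
           (trans ([]-∧ (does (x ~? y)) _) (cong (_* [ does (j Fin.≟ part y) ]) (adj-split x y)))) ⟩
    ∑[ y < q * n ] ([ not (does (part x Fin.≟ part y)) ] * compat (side x) (side y) *
                    [ does (j Fin.≟ part y) ])
      ≡⟨ sum-cong-≗ {q * n} (λ y → solve 3 (λ u v w → u :* v :* w := w :* u :* v) refl
           [ not (does (part x Fin.≟ part y)) ]
           (compat (side x) (side y)) [ does (j Fin.≟ part y) ]) ⟩
    ∑[ y < q * n ] ([ does (j Fin.≟ part y) ] * [ not (does (part x Fin.≟ part y)) ] *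
                    compat (side x) (side y))
      ≡⟨ sum-vertices (λ i → [ does (j Fin.≟ i) ] * [ not (does (part x Fin.≟ i)) ])
           (compat (side x)) ⟩
    ∑[ i < q ] ([ does (j Fin.≟ i) ] * [ not (does (part x Fin.≟ i)) ]) * sumSide (compat (side x))
      ≡⟨ cong₂ _*_ (trans (sum-≟ j λ i → [ not (does (part x Fin.≟ i)) ])
                          (cong (λ t → [ not t ]) (dec-false (part x Fin.≟ j) (≢-sym j≢))))
                   (sumSide-compat (side x)) ⟩
    1 * (e + r₁ + r₂)
      ≡⟨ ℕ.*-identityˡ _ ⟩
    e + r₁ + r₂ ∎
    where
    open ≡-Reasoning
    open ℕ.+-*-Solver using (solve; _:*_; _:=_)

  open PartiteGraph partiteGraph using (Balanced; PartiteDivisible; δ̂; partiteDegrees)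

  balanced : Balanced
  balanced i j = trans (size i) (sym (size j))
    where
    size : ∀ j → Subset.∣ V j ∣ ≡ 1 * sumSide (λ _ → 1)
    size j = begin
      Subset.∣ V j ∣
        ≡⟨ ∣∣-sum (V j) ⟩
      ∑[ x < q * n ] [ lookup (V j) x ]
        ≡⟨ sum-cong-≗ {q * n} (λ x →
             trans (cong [_] (lookup-V j x)) (sym (ℕ.*-identityʳ _))) ⟩
      ∑[ x < q * n ] ([ does (j Fin.≟ part x) ] * 1)
        ≡⟨ sum-vertices (λ i → [ does (j Fin.≟ i) ]) (λ _ → 1) ⟩
      ∑[ i < q ] [ does (j Fin.≟ i) ] * sumSide (λ _ → 1)
        ≡⟨ cong (_* sumSide (λ _ → 1)) (trans
             (sum-cong-≗ λ i → sym (ℕ.*-identityʳ [ does (j Fin.≟ i) ]))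
             (sum-≟ j λ _ → 1)) ⟩
      1 * sumSide (λ _ → 1) ∎
      where open ≡-Reasoning

  divisible : PartiteDivisible
  divisible j₁ j₂ _ x x∉ = trans
    (degree x j₁ λ eq → x∉ (Subset.x∈p∪q⁺ (inj₁ (∈V⇐ j₁ eq))))
    (sym (degree x j₂ λ eq → x∉ (Subset.x∈p∪q⁺ {p = V j₁} (inj₂ (∈V⇐ j₂ eq)))))

  δ̂≥ : e + r₁ + r₂ ≤ δ̂
  -- The first argument bounds the default value `q * n` of the minimum, the second every listed
  -- degree.
  δ̂≥ = v≤min⁺ (ℕ.≤-trans (ℕ.+-monoʳ-≤ a (ℕ.m≤n+m r₂ e)) (ℕ.m≤n*m n q))
    (All.concat⁺ (All.map⁺ (All.universal (λ j → All.map⁺ (All.map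
      (λ {x} x∉ → ℕ.≤-reflexive (sym (degree x j λ eq → x∉ (∈V⇐ j eq))))
      (All.all-filter _ (List.allFin (q * n))))) (List.allFin q))))

  α β : Side → ℕ
  α (inj₁ _) = 1
  α (inj₂ _) = 0
  β (inj₁ _) = 0
  β (inj₂ _) = 1

  -- The positive and negative parts of the weighting, for q = c + 2, as product forms in the
  -- indicators `α` of A and `β` of B.
  weight⁺ weight⁻ : Side → Side → ℕ
  weight⁺ s t = suc c * c * α s * α t + 2 * β s * β t
  weight⁻ s t = c * α s * β t + c * β s * α t

  weighted : (Side → Side → ℕ) → Fin (q * n) → Fin (q * n) → ℕ
  weighted p x y = adj graph x y * p (side x) (side y)

  weighted-≁ : ∀ p x y → ¬ (x ~ y) → weighted p x y ≡ 0
  weighted-≁ p x y x≁y = cong (_* p (side x) (side y)) (adj-≁ graph x y x≁y)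

  other-parts : ∀ i → ∑[ j < q ] [ not (does (i Fin.≟ j)) ] ≡ suc c
  other-parts i = ℕ.+-cancelˡ-≡ 1 _ _ (begin
    1 + ∑[ j < q ] [ not (does (i Fin.≟ j)) ]
      ≡⟨ cong (_+ ∑[ j < q ] [ not (does (i Fin.≟ j)) ]) (sym (sum-≟ i λ _ → 1)) ⟩
    ∑[ j < q ] ([ does (i Fin.≟ j) ] * 1) + ∑[ j < q ] [ not (does (i Fin.≟ j)) ]
      ≡⟨ sym (∑-distrib-+ {q} (λ j → [ does (i Fin.≟ j) ] * 1) λ j → [ not (does (i Fin.≟ j)) ]) ⟩
    ∑[ j < q ] ([ does (i Fin.≟ j) ] * 1 + [ not (does (i Fin.≟ j)) ])
      ≡⟨ sum-cong-≗ {q} (λ j → trans (cong (_+ [ not (does (i Fin.≟ j)) ]) (ℕ.*-identityʳ _))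
                                 ([]+[not] (does (i Fin.≟ j)))) ⟩
    ∑[ j < q ] 1
      ≡⟨ sum-1 q ⟩
    q ∎)
    where open ≡-Reasoning

  -- The weight depends on the sides alone, so each of the q (q - 1) ordered pairs of distinct parts
  -- contributes the same sum.
  total-weighted : ∀ p → Σ² (weighted p) ≡
                   q * (suc c * sumSide λ s → sumSide λ t → compat s t * p s t)
  total-weighted p = begin
    Σ² (weighted p)
      ≡⟨ Σ²-cong (λ x y → trans (cong (_* p (side x) (side y)) (adj-split x y))
           (ℕ.*-assoc [ not (does (part x Fin.≟ part y)) ] _ _)) ⟩
    Σ² (λ x y → [ not (does (part x Fin.≟ part y)) ] *
                (compat (side x) (side y) * p (side x) (side y)))
      ≡⟨ sum-cong-≗ (λ x → trans
           (sum-vertices (λ j → [ not (does (part x Fin.≟ j)) ])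
             (λ t → compat (side x) t * p (side x) t))
           (trans (cong (_* R (side x)) (other-parts (part x)))
             (sym (ℕ.*-identityˡ (suc c * R (side x)))))) ⟩
    ∑[ x < q * n ] (1 * (suc c * R (side x)))
      ≡⟨ sum-vertices (λ _ → 1) (λ s → suc c * R s) ⟩
    ∑[ i < q ] 1 * sumSide (λ s → suc c * R s)
      ≡⟨ cong₂ _*_ (sum-1 q) (trans
           (sym (cong₂ _+_ (*-distribˡ-sum (suc c) (R ∘ inj₁)) (*-distribˡ-sum (suc c) (R ∘ inj₂))))
           (sym (ℕ.*-distribˡ-+ (suc c) (sum (R ∘ inj₁)) (sum (R ∘ inj₂))))) ⟩
    q * (suc c * sumSide R) ∎
    where
    open ≡-Reasoning
    R : Side → ℕ
    R s = sumSide λ t → compat s t * p s t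

  sumSide-weight : ∀ (p : Side → Side → ℕ) k₁₁ k₁₂ k₂₁ k₂₂ →
    (∀ i j → p (inj₁ i) (inj₁ j) ≡ k₁₁) → (∀ i j → p (inj₁ i) (inj₂ j) ≡ k₁₂) →
    (∀ i j → p (inj₂ i) (inj₁ j) ≡ k₂₁) → (∀ i j → p (inj₂ i) (inj₂ j) ≡ k₂₂) →
    sumSide (λ s → sumSide λ t → compat s t * p s t) ≡
    a * (r₁ * k₁₁ + b * k₁₂) + b * (a * k₂₁ + r₂ * k₂₂)
  sumSide-weight p k₁₁ k₁₂ k₂₁ k₂₂ p₁₁ p₁₂ p₂₁ p₂₂ = cong₂ _+_
    (trans (sum-cong-≗ {a} λ i → cong₂ _+_
        (term (λ j → compat (inj₁ i) (inj₁ j)) (λ j → p (inj₁ i) (inj₁ j)) (sum-compat₁ i) (p₁₁ i))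
        (term (λ j → compat (inj₁ i) (inj₂ j)) (λ j → p (inj₁ i) (inj₂ j)) (sum-1 b) (p₁₂ i)))
      (sum-const a _))
    (trans (sum-cong-≗ {b} λ i → cong₂ _+_
        (term (λ j → compat (inj₂ i) (inj₁ j)) (λ j → p (inj₂ i) (inj₁ j)) (sum-1 a) (p₂₁ i))
        (term (λ j → compat (inj₂ i) (inj₂ j)) (λ j → p (inj₂ i) (inj₂ j)) (sum-compat₂ i) (p₂₂ i)))
      (sum-const b _))
    where
    term : ∀ {m r k} (f g : Fin m → ℕ) →
           sum f ≡ r → (∀ j → g j ≡ k) → ∑[ j < m ] (f j * g j) ≡ r * k
    term {k = k} f g sum≡r g≡k = trans (sum-cong-≗ λ j → cong (f j *_) (g≡k j))
      (trans (sym (*-distribʳ-sum k f)) (cong (_* k) sum≡r))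

  module _ (S : Subset (q * n)) (S-copy : Decompositions.IsCopy q graph S) where

    g : Fin (q * n) → ℕ
    g x = [ lookup S x ]

    countA countB : ℕ
    countA = ∑[ x < q * n ] (g x * α (side x))
    countB = ∑[ x < q * n ] (g x * β (side x))

    countA+countB : countA + countB ≡ q
    countA+countB = begin
      countA + countB
        ≡⟨ sym (∑-distrib-+ (λ x → g x * α (side x)) (λ x → g x * β (side x))) ⟩
      ∑[ x < q * n ] (g x * α (side x) + g x * β (side x))
        ≡⟨ sum-cong-≗ (λ x → α+β (g x) (side x)) ⟩
      sum g
        ≡⟨ sym (∣∣-sum S) ⟩
      Subset.∣ S ∣
        ≡⟨ proj₁ S-copy ⟩
      q ∎
      where
      open ≡-Reasoning
      α+β : ∀ m s → m * α s + m * β s ≡ m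
      α+β m (inj₁ _) = trans (cong₂ _+_ (ℕ.*-identityʳ m) (ℕ.*-zeroʳ m)) (ℕ.+-identityʳ m)
      α+β m (inj₂ _) = cong₂ _+_ (ℕ.*-zeroʳ m) (ℕ.*-identityʳ m)

    inner-bilinear : ∀ k k′ (u u′ w w′ : Side → ℕ) →
      inner (λ x y → k * u (side x) * u′ (side y) + k′ * w (side x) * w′ (side y)) S ≡
      k * ∑[ x < q * n ] (g x * u (side x)) * ∑[ x < q * n ] (g x * u′ (side x)) +
      k′ * ∑[ x < q * n ] (g x * w (side x)) * ∑[ x < q * n ] (g x * w′ (side x))
    inner-bilinear k k′ u u′ w w′ = trans
      (Σ²-cong λ x y → solve 8 (λ gx gy k k′ u u′ w w′ →
          gx :* gy :* (k :* u :* u′ :+ k′ :* w :* w′) :=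
          k :* (gx :* u) :* (gy :* u′) :+ k′ :* (gx :* w) :* (gy :* w′)) refl
        (g x) (g y) k k′ (u (side x)) (u′ (side y)) (w (side x)) (w′ (side y)))
      (Σ²-bilinear k k′ (λ x → g x * u (side x)) (λ x → g x * u′ (side x))
                        (λ x → g x * w (side x)) (λ x → g x * w′ (side x)))
      where open ℕ.+-*-Solver using (solve; _:+_; _:*_; _:=_)

    diagonal⁺ : ∑[ x < q * n ] (g x * weight⁺ (side x) (side x)) ≡ suc c * c * countA + 2 * countB
    diagonal⁺ = begin
      ∑[ x < q * n ] (g x * weight⁺ (side x) (side x))
        ≡⟨ sum-cong-≗ (λ x → pointwise (g x) (side x)) ⟩
      ∑[ x < q * n ] (suc c * c * (g x * α (side x)) + 2 * (g x * β (side x)))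
        ≡⟨ ∑-distrib-+ (λ x → suc c * c * (g x * α (side x))) _ ⟩
      ∑[ x < q * n ] (suc c * c * (g x * α (side x))) + ∑[ x < q * n ] (2 * (g x * β (side x)))
        ≡⟨ sym (cong₂ _+_ (*-distribˡ-sum (suc c * c) λ x → g x * α (side x))
                        (*-distribˡ-sum 2 λ x → g x * β (side x))) ⟩
      suc c * c * countA + 2 * countB ∎
      where
      open ≡-Reasoning
      open ℕ.+-*-Solver using (solve; con; _:+_; _:*_; _:=_)
      pointwise : ∀ m s → m * weight⁺ s s ≡ suc c * c * (m * α s) + 2 * (m * β s)
      pointwise m (inj₁ _) = solve 2 (λ m k →
        m :* (k :* con 1 :* con 1 :+ con 2 :* con 0 :* con 0) :=
        k :* (m :* con 1) :+ con 2 :* (m :* con 0)) refl m (suc c * c)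
      pointwise m (inj₂ _) = solve 2 (λ m k →
        m :* (k :* con 0 :* con 0 :+ con 2 :* con 1 :* con 1) :=
        k :* (m :* con 0) :+ con 2 :* (m :* con 1)) refl m (suc c * c)

    -- With the diagonal terms of `weight⁺` added to both sides, the comparison becomes the
    -- polynomial inequality `clique-weight≥0` in `countA` and `countB`.
    copy≥0 : inner (weighted weight⁻) S ≤ inner (weighted weight⁺) S
    copy≥0 = ℕ.+-cancelʳ-≤ (suc c * c * countA + 2 * countB) _ _ (begin
      inner (weighted weight⁻) S + (suc c * c * countA + 2 * countB)
        -- The inserted diagonal of `weight⁻` is in fact zero, since no vertex lies in both A and B.
        ≤⟨ ℕ.+-monoˡ-≤ (suc c * c * countA + 2 * countB) (ℕ.m≤m+n (inner (weighted weight⁻) S) _) ⟩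
      inner (weighted weight⁻) S + ∑[ x < q * n ] (g x * weight⁻ (side x) (side x)) +
      (suc c * c * countA + 2 * countB)
        ≡⟨ cong (_+ (suc c * c * countA + 2 * countB)) (trans
             (inner-adj graph (λ x y → weight⁻ (side x) (side y)) S S-copy)
             (inner-bilinear c c α β β α)) ⟩
      c * countA * countB + c * countB * countA + (suc c * c * countA + 2 * countB)
        ≡⟨ cong (_+ (suc c * c * countA + 2 * countB))
             (solve 3 (λ c x y → c :* x :* y :+ c :* y :* x := con 2 :* c :* x :* y)
               refl c countA countB) ⟩
      2 * c * countA * countB + (suc c * c * countA + 2 * countB)
        ≤⟨ clique-weight≥0 c countA countB countA+countB ⟩
      suc c * c * countA * countA + 2 * countB * countB
        ≡⟨ sym (trans (inner-adj graph (λ x y → weight⁺ (side x) (side y)) S S-copy)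
                      (inner-bilinear (suc c * c) 2 α α β β)) ⟩
      inner (weighted weight⁺) S + ∑[ x < q * n ] (g x * weight⁺ (side x) (side x))
        ≡⟨ cong (inner (weighted weight⁺) S +_) diagonal⁺ ⟩
      inner (weighted weight⁺) S + (suc c * c * countA + 2 * countB) ∎)
      where
      open ℕ.≤-Reasoning
      open ℕ.+-*-Solver using (solve; con; _:+_; _:*_; _:=_)

  module _ (unbalanced : suc c * c * a * r₁ + 2 * b * r₂ < 2 * c * a * b) where

    -- After cancelling the common factor q (q - 1), what remains is `unbalanced`, the comparison
    -- for a single ordered pair of parts.
    total<0 : Σ² (weighted weight⁺) < Σ² (weighted weight⁻)
    total<0 = subst₂ _<_ (sym total⁺) (sym total⁻)
      (ℕ.*-monoʳ-< q (ℕ.*-monoʳ-< (suc c) unbalanced))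
      where
      open ℕ.+-*-Solver using (solve; con; _:+_; _:*_; _:=_)
      k = suc c * c
      total⁺ : Σ² (weighted weight⁺) ≡ q * (suc c * (k * a * r₁ + 2 * b * r₂))
      total⁺ = trans (total-weighted weight⁺) (cong (λ t → q * (suc c * t)) (trans
        (sumSide-weight weight⁺ k 0 0 2
          (λ _ _ → solve 1 (λ k → k :* con 1 :* con 1 :+ con 2 :* con 0 :* con 0 := k) refl k)
          (λ _ _ → solve 1 (λ k → k :* con 1 :* con 0 :+ con 2 :* con 0 :* con 1 := con 0) refl k)
          (λ _ _ → solve 1 (λ k → k :* con 0 :* con 1 :+ con 2 :* con 1 :* con 0 := con 0) refl k)
          (λ _ _ → solve 1 (λ k → k :* con 0 :* con 0 :+ con 2 :* con 1 :* con 1 := con 2) refl k))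
        (solve 5 (λ k a b r s → a :* (r :* k :+ b :* con 0) :+ b :* (a :* con 0 :+ s :* con 2) :=
                                k :* a :* r :+ con 2 :* b :* s) refl k a b r₁ r₂)))
      total⁻ : Σ² (weighted weight⁻) ≡ q * (suc c * (2 * c * a * b))
      total⁻ = trans (total-weighted weight⁻) (cong (λ t → q * (suc c * t)) (trans
        (sumSide-weight weight⁻ 0 c c 0
          (λ _ _ → solve 1 (λ k → k :* con 1 :* con 0 :+ k :* con 0 :* con 1 := con 0) refl c)
          (λ _ _ → solve 1 (λ k → k :* con 1 :* con 1 :+ k :* con 0 :* con 0 := k) refl c)
          (λ _ _ → solve 1 (λ k → k :* con 0 :* con 0 :+ k :* con 1 :* con 1 := k) refl c)
          (λ _ _ → solve 1 (λ k → k :* con 0 :* con 1 :+ k :* con 1 :* con 0 := con 0) refl c))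
        (solve 5 (λ k a b r s → a :* (r :* con 0 :+ b :* k) :+ b :* (a :* k :+ s :* con 0) :=
                                con 2 :* k :* a :* b) refl c a b r₁ r₂)))

    open Obstruction q graph (weighted weight⁺) (weighted weight⁻)
      (weighted-≁ weight⁺) (weighted-≁ weight⁻) copy≥0 total<0 public
      using (no-decomposition; no-fractional)

-- Evaluating the degree threshold.

/-ι : ∀ d n .{{_ : NonZero d}} → ℤ.+ (d * n) ℚ./ d ≡ ι n
/-ι (suc d) n = ℚ.fromℚᵘ-cong {ℚᵘ.mkℚᵘ (ℤ.+ (suc d * n)) d} {ℚᵘ.mkℚᵘ (ℤ.+ n) 0} (ℚᵘ.*≡* (begin
  ℤ.+ (suc d * n) ℤ.* ℤ.1ℤ    ≡⟨ ℤ.*-identityʳ _ ⟩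
  ℤ.+ (suc d * n)             ≡⟨ cong ℤ.+_ (ℕ.*-comm (suc d) n) ⟩
  ℤ.+ (n * suc d)             ≡⟨ ℤ.pos-* n (suc d) ⟩
  ℤ.+ n ℤ.* ℤ.+ suc d         ∎))
  where open ≡-Reasoning

-- With `z` the ratio of the part size `m + e` to `e`, the factor removes exactly `e`.
[1-1/z]*n : ∀ z .{{_ : ℚ.NonZero z}} m e → ι (m + e) ≡ z ℚ.* ι e →
            (1ℚ ℚ.+ ℚ.- (ℚ.1/ z)) ℚ.* ι (m + e) ≡ ι m
[1-1/z]*n z m e n≡ze = begin
  (1ℚ ℚ.+ ℚ.- i) ℚ.* ι (m + e)
    ≡⟨ solve 2 (λ i n → (con 1ℚ :+ (:- i)) :* n := n :- i :* n) refl i (ι (m + e)) ⟩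
  ι (m + e) ℚ.- i ℚ.* ι (m + e)
    ≡⟨ cong₂ (λ s t → s ℚ.- i ℚ.* t) (ι-+ m e) n≡ze ⟩
  ι m ℚ.+ ι e ℚ.- i ℚ.* (z ℚ.* ι e)
    ≡⟨ cong (λ t → ι m ℚ.+ ι e ℚ.- t) (trans (sym (ℚ.*-assoc i z (ι e)))
         (trans (cong (ℚ._* ι e) (ℚ.*-inverseˡ z)) (ℚ.*-identityˡ (ι e)))) ⟩
  ι m ℚ.+ ι e ℚ.- ι e
    ≡⟨ solve 2 (λ m e → m :+ e :- e := m) refl (ι m) (ι e) ⟩
  ι m ∎
  where
  open ≡-Reasoning
  open ℚ.+-*-Solver using (solve; con; _:+_; _:-_; :-_; _:*_; _:=_)
  i : ℚ
  i = ℚ.1/ z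

-- The explicit constant and the infinite family.

module Parameters (t : ℕ) where

  -- c is 8 q (q - 1) / ((7 q - 9) (q + 1)), and K + 1 is its denominator.
  q D E K : ℕ
  q = 4 + t
  D = 8 * (4 + t) * (3 + t)
  E = 19 + 7 * t
  K = 4 + t + (18 + 7 * t) * (5 + t)

  c : ℚ
  c = ι D ℚ.* ι⁻¹ K

  -- This is c - 1, because 8 q (q - 1) - (7 q - 9) (q + 1) = (q - 3)². It is positive for q at
  -- least 4.
  c-excess : ℚ
  c-excess = ι ((1 + t) * (1 + t)) ℚ.* ι⁻¹ K

  1<c : 1ℝ <ℝ fromℚ c
  1<c = c-excess , excess>0 , 0 , λ _ _ → ℚ.≤-reflexive (sym c≡)
    where
    excess>0 : 0ℚ ℚ.< c-excess
    excess>0 = subst (ℚ._< c-excess) (ℚ.*-zeroˡ (ι⁻¹ K))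
      (ℚ.*-monoˡ-<-pos (ι⁻¹ K) {{ℚ.positive (ι⁻¹>0 K)}} (0<ι (t + t * suc t)))
    D≡ : D ≡ suc K + (1 + t) * (1 + t)
    D≡ = solve 1 (λ t → con 8 :* (con 4 :+ t) :* (con 3 :+ t) :=
      con 5 :+ t :+ (con 18 :+ con 7 :* t) :* (con 5 :+ t) :+ (con 1 :+ t) :* (con 1 :+ t)) refl t
      where open ℕ.+-*-Solver using (solve; con; _:+_; _:*_; _:=_)
    c≡ : c ≡ 1ℚ ℚ.+ c-excess
    c≡ = begin
      ι D ℚ.* ι⁻¹ K
        ≡⟨ cong (λ d → ι d ℚ.* ι⁻¹ K) D≡ ⟩
      ι (suc K + (1 + t) * (1 + t)) ℚ.* ι⁻¹ K
        ≡⟨ cong (ℚ._* ι⁻¹ K) (ι-+ (suc K) _) ⟩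
      (ι (suc K) ℚ.+ ι ((1 + t) * (1 + t))) ℚ.* ι⁻¹ K
        ≡⟨ ℚ.*-distribʳ-+ (ι⁻¹ K) (ι (suc K)) _ ⟩
      ι (suc K) ℚ.* ι⁻¹ K ℚ.+ c-excess
        ≡⟨ cong (ℚ._+ c-excess) (trans (ℚ.*-comm (ι (suc K)) _) (ι⁻¹-inverseˡ K)) ⟩
      1ℚ ℚ.+ c-excess ∎
      where open ≡-Reasoning

  -- Thus c (q + 1) is `D / E`, the ratio of part size to missing degree in every member of the
  -- family. The form of `K` lets `suc K` and `E * suc q` agree by computation.
  c*[q+1]*E : c ℚ.* ι (suc q) ℚ.* ι E ≡ ι D
  c*[q+1]*E = begin
    c ℚ.* ι (suc q) ℚ.* ι E             ≡⟨ ℚ.*-assoc c _ _ ⟩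
    c ℚ.* (ι (suc q) ℚ.* ι E)           ≡⟨ cong (c ℚ.*_) (trans (ℚ.*-comm (ι (suc q)) (ι E))
                                                               (sym (ι-* E (suc q)))) ⟩
    ι D ℚ.* ι⁻¹ K ℚ.* ι (suc K)         ≡⟨ ℚ.*-assoc (ι D) _ _ ⟩
    ι D ℚ.* (ι⁻¹ K ℚ.* ι (suc K))       ≡⟨ cong (ι D ℚ.*_) (ι⁻¹-inverseˡ K) ⟩
    ι D ℚ.* 1ℚ                          ≡⟨ ℚ.*-identityʳ (ι D) ⟩
    ι D                                 ∎
    where open ≡-Reasoning

  module Member (i : ℕ) where

    -- For m = 4 (q - 1) k, this makes ∣ A ∣ = 3 m and ∣ B ∣ = (2 q - 3) m in each
    -- part. The obstruction needs e / m > (5 q - 9) / (3 q - 5), and c > 1 needs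
    -- e / m < 2 q / (q + 1); e / m is the mediant (7 q - 9) / (4 q - 4).
    k e r₁ r₂ : ℕ
    k  = suc i
    e  = E * k
    r₁ = (17 + 5 * t) * k
    r₂ = (41 + 37 * t + 8 * t * t) * k

    open ℕ.+-*-Solver using (solve; con; _:+_; _:*_; _:=_)

    open Construction (2 + t) e r₁ r₂ public
      using (n; partiteGraph; balanced; divisible; δ̂≥; no-decomposition; no-fractional)

    n≡ : n ≡ D * k
    n≡ = solve 2 (λ t k →
      (con 19 :+ con 7 :* t) :* k :+ (con 17 :+ con 5 :* t) :* k :+
        ((con 19 :+ con 7 :* t) :* k :+ (con 41 :+ con 37 :* t :+ con 8 :* t :* t) :* k) :=
      con 8 :* (con 4 :+ t) :* (con 3 :+ t) :* k) refl t k

    -- The sides differ by 4 q (q - 1) (q - 3)² k², which is positive since q is at least 4 and `k`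
    -- is a successor.
    unbalanced : (3 + t) * (2 + t) * (e + r₁) * r₁ + 2 * (e + r₂) * r₂ <
                 2 * (2 + t) * (e + r₁) * (e + r₂)
    unbalanced = subst ((3 + t) * (2 + t) * (e + r₁) * r₁ + 2 * (e + r₂) * r₂ <_)
      (solve 2 (λ t k → let
          e = (con 19 :+ con 7 :* t) :* k
          r₁ = (con 17 :+ con 5 :* t) :* k
          r₂ = (con 41 :+ con 37 :* t :+ con 8 :* t :* t) :* k in
        (con 3 :+ t) :* (con 2 :+ t) :* (e :+ r₁) :* r₁ :+ con 2 :* (e :+ r₂) :* r₂ :+
          con 4 :* (con 3 :+ t) :* (con 4 :+ t) :* (con 1 :+ t) :* (con 1 :+ t) :* k :* k :=
        con 2 :* (con 2 :+ t) :* (e :+ r₁) :* (e :+ r₂)) refl t k)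
      (ℕ.m<m+n _ {4 * (3 + t) * (4 + t) * (1 + t) * (1 + t) * k * k} (s≤s z≤n))

    open PartiteGraph partiteGraph using (v; δ̂)

    degree+e : e + r₁ + r₂ + e ≡ n
    degree+e = trans (ℕ.+-assoc (e + r₁) r₂ e) (cong (e + r₁ +_) (ℕ.+-comm r₂ e))

    ιn : ∀ z → z ℚ.* ι E ≡ ι D → ι (e + r₁ + r₂ + e) ≡ z ℚ.* ι e
    ιn z zE≡D = begin
      ι (e + r₁ + r₂ + e)       ≡⟨ cong ι (trans degree+e n≡) ⟩
      ι (D * k)                 ≡⟨ ι-* D k ⟩
      ι D ℚ.* ι k               ≡⟨ cong (ℚ._* ι k) (sym zE≡D) ⟩
      z ℚ.* ι E ℚ.* ι k         ≡⟨ ℚ.*-assoc z _ _ ⟩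
      z ℚ.* (ι E ℚ.* ι k)       ≡⟨ cong (z ℚ.*_) (sym (ι-* E k)) ⟩
      z ℚ.* ι e                 ∎
      where open ≡-Reasoning

    -- The threshold is exactly the common degree, the part size minus `e`. Leaving `z` and the
    -- proof that it is nonzero arbitrary lets this match the reciprocal formed by `recip`.
    threshold≡ : ∀ z .{{_ : ℚ.NonZero z}} → z ℚ.* ι E ≡ ι D →
                 (1ℚ ℚ.+ ℚ.- (ℚ.1/ z)) ℚ.* (ℤ.+ v ℚ./ q) ≡ ι (e + r₁ + r₂)
    threshold≡ z zE≡D = trans
      (cong ((1ℚ ℚ.+ ℚ.- (ℚ.1/ z)) ℚ.*_) (trans (/-ι q n) (cong ι (sym degree+e))))
      ([1-1/z]*n z (e + r₁ + r₂) e (ιn z zE≡D))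

    threshold≤δ̂ : threshold (fromℚ c) 1<c q v ≤ℝ fromℕ δ̂
    -- All reals involved are constant sequences, so index 0 serves and one rational inequality is
    -- left.
    threshold≤δ̂ ε 0<ε = 0 , λ _ _ → begin
      (1ℚ ℚ.+ ℚ.- (ℚ.1/ (c ℚ.* ι (suc q))) {{_}}) ℚ.* (ℤ.+ v ℚ./ q)
                              ≡⟨ threshold≡ (c ℚ.* ι (suc q)) {{_}} c*[q+1]*E ⟩
      ι (e + r₁ + r₂)         ≤⟨ ι-mono δ̂≥ ⟩
      ι δ̂                     ≡⟨ sym (ℚ.+-identityʳ (ι δ̂)) ⟩
      ι δ̂ ℚ.+ 0ℚ              ≤⟨ ℚ.+-monoʳ-≤ (ι δ̂) (ℚ.<⇒≤ 0<ε) ⟩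
      ι δ̂ ℚ.+ ε               ∎
      where open ℚ.≤-Reasoning

  -- An isomorphism preserves the number of vertices, which is q D (i + 1) for member `i`.
  non-isomorphic : ∀ i j → i ≢ j →
    ¬ (PartiteGraph.graph (Member.partiteGraph i) ≅ PartiteGraph.graph (Member.partiteGraph j))
  non-isomorphic i j i≢j iso = i≢j (ℕ.suc-injective (ℕ.*-cancelˡ-≡ (suc i) (suc j) D
    (trans (sym (Member.n≡ i)) (trans
      (ℕ.*-cancelˡ-≡ (Member.n i) (Member.n j) q (↔⇒≡ (_≅_.bijection iso)))
      (Member.n≡ j)))))

theorem1p7 : (q : ℕ) (4≤q : 4 ≤ q) →
    ∃[ c ] Σ (1ℝ <ℝ c) λ 1<c →
    Σ (ℕ → PartiteGraph q) λ G → let open PartiteGraph in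
    (∀ i j → i ≢ j → ¬ (graph (G i) ≅ graph (G j))) ×
    (∀ i →
    Balanced (G i) ×
    PartiteDivisible (G i) ×
    threshold c 1<c q {{>-nonZero (≤-trans (s≤s z≤n) 4≤q)}} (v (G i)) ≤ℝ fromℕ (δ̂ (G i)) ×
    ¬ Decomposition q (graph (G i)) ×
    ¬ FractionalDecomposition q (graph (G i)))
-- Writing q = 4 + t turns the polynomials in q into polynomials in `t` with natural coefficients,
-- and makes the positivity of q - 3 visible as `1 + t`.
theorem1p7 (suc (suc (suc (suc t)))) (s≤s (s≤s (s≤s (s≤s z≤n)))) =
  fromℚ c , 1<c , (λ i → Member.partiteGraph i) , non-isomorphic , λ i →
    Member.balanced i , Member.divisible i , Member.threshold≤δ̂ i ,
    Member.no-decomposition i (Member.unbalanced i) , Member.no-fractional i (Member.unbalanced i)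
  where open Parameters t
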